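{- There exists an absolute constant $D$ such that the following holds. Let $k\ge1$ and $n$ be integers with $n\ge (k^3+2k^2+k)/2$ or $n\ge k^2/4+5k+D$. For each $i\in\{1,\dots,k\}$, let $m_i\ge 0$ be integers and let $\mathcal{F}_{i,j}\subseteq \binom{[n]}{k}$ for $1\le j\le m_i$. Suppose that any two distinct families $\mathcal{F}_{i,j}$ and $\mathcal{F}_{i',j'}$ (i.e. $(i,j)\neq(i',j')$) are cross-$\max\{i,i'\}$-intersecting. Put \[ M_s:=\max\!\left\{1,\sum_{r=1}^s m_r\right\}\qquad (0\le s\le k). \] Then \[ \sum_{i=1}^k\sum_{j=1}^{m_i}|\mathcal{F}_{i,j}| \le \max_{0\le s\le k}M_s\binom{n-s}{k-s}. \]
   Context: $\binom{[n]}{k}$ denotes the family of all $k$-element subsets of $[n]$. Two families $\mathcal{A},\mathcal{B}\subseteq\binom{[n]}{k}$ are cross-$t$-intersecting if $|A\cap B|\ge t$ for every $A\in\mathcal{A}$ and $B\in\mathcal{B}$. -}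

module Defs where

open import Data.Nat using (ℕ; zero; suc; _+_; _*_; _⊔_; _<ᵇ_; _≤_)
open import Data.Fin using (Fin; toℕ)
open import Data.Fin.Subset using (Subset; ∣_∣; _∩_)
open import Data.Bool using (if_then_else_)
open import Data.List using (List)
open import Data.List.Membership.Propositional using (_∈_)
open import Data.List.Relation.Unary.All using (All)
open import Data.List.Relation.Unary.Unique.Propositional using (Unique)
open import Relation.Binary.PropositionalEquality using (_≡_)

sumFin : (n : ℕ) → (Fin n → ℕ) → ℕ
sumFin zero    f = 0
sumFin (suc n) f = f Fin.zero + sumFin n (λ i → f (Fin.suc i))

maxUpTo : ℕ → (ℕ → ℕ) → ℕ
maxUpTo zero    f = f 0
maxUpTo (suc k) f = maxUpTo k f ⊔ f (suc k)

-- m_1 + ... + m_s, where m is indexed by Fin k (index r : Fin k stands for r+1)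
partialSum : (k : ℕ) → (Fin k → ℕ) → ℕ → ℕ
partialSum k m s = sumFin k (λ r → if toℕ r <ᵇ s then m r else 0)

M : (k : ℕ) → (Fin k → ℕ) → ℕ → ℕ
M k m s = 1 ⊔ partialSum k m s

-- a finite family of subsets of [n], represented as a duplicate-free list;
-- its cardinality is the length of the list
-- F ⊆ ([n] choose k)
IsKFamily : {n : ℕ} → ℕ → List (Subset n) → Set
IsKFamily k F = Unique F × All (λ A → ∣ A ∣ ≡ k) F
  where open import Data.Product using (_×_)

CrossInt : {n : ℕ} → ℕ → List (Subset n) → List (Subset n) → Set
CrossInt t 𝒜 ℬ = ∀ {A B} → A ∈ 𝒜 → B ∈ ℬ → t ≤ ∣ A ∩ B ∣

{-# OPTIONS --safe #-}

-- Give a k-set A level 0 if it lies in one family only, and otherwise the largest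
-- level of a family containing it.  Then |A ∩ B| ≥ max(level A, level B) for all
-- A, B, also when both lie in the family attaining the level, since then a second
-- family containing one of them can be used.  As A lies in at most M_(level A)
-- families, it suffices that Σ_A M_(level A) ≤ X whenever M_s C(n-s, k-s) ≤ X
-- for all s, with M nondecreasing.
--
-- A level function on the subsets of an l-set, extended freely to the other n - l
-- points, is pushed down one point at a time (in the manner of Ahlswede and
-- Khachatrian) without losing weight.  Let 0 be the point to remove and shift 0 to
-- all other points.  After shifting, E and F can both receive the levels of E ∪ 0 and
-- F ∪ 0 if some point x misses both.  For l ≥ 2k this happens for all relevant pairs.
-- For l < 2k, take a random x and raise exactly the sets missing x: this does not lose
-- on average because e (k - e) ≤ k²/4 ≤ n - k - 1, except possibly on the full set.
-- With B the largest level, the full set can instead be given level B if the sets of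
-- size B - 1 are dropped, and one of the two options never loses.  The process stops
-- when all levels are 0 or when only the full set is left, where the bound is a
-- hypothesis.
module Submission where

open import Defs
open import Data.Bool using (Bool; true; false; T; _∧_; if_then_else_)
import Data.Bool.Properties as Bool
open import Data.Fin using (Fin; toℕ; zero; suc)
import Data.Fin.Properties as Fin
open import Data.Fin.Subset using (Subset; ∣_∣; _∩_; inside; outside; ⊤)
open import Data.Fin.Subset.Properties using (∣p∣≤n; ∣⊤∣≡n; ∣p∣≡n⇒p≡⊤; ∣p∩q∣≤∣q∣; ∩-identityˡ; ∩-idem; ∩-comm)
open import Data.List using (List; []; _∷_; length; allFin)
open import Data.List.Membership.Propositional using (_∈_)
open import Data.List.Membership.Propositional.Properties using (∈-allFin)
open import Data.List.Relation.Unary.All as All using ()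
open import Data.List.Relation.Unary.AllPairs using ([]; _∷_)
open import Data.List.Relation.Unary.Any using (here; there)
open import Data.List.Relation.Unary.Unique.Propositional using (Unique)
open import Data.Nat
open import Data.Nat.Combinatorics using (_C_; nCk+nC[k+1]≡[n+1]C[k+1])
open import Data.Nat.Properties
open import Data.Nat.Tactic.RingSolver using (solve-∀)
open import Data.Product using (Σ; ∃; _,_; _×_; proj₁; proj₂)
import Data.Product.Properties as Product
open import Data.Sum using (_⊎_; inj₁; inj₂; [_,_]′)
open import Data.Vec using ([]; _∷_; lookup; insertAt; removeAt)
open import Data.Vec.Properties using (≡-dec; insertAt-lookup; removeAt-insertAt; insertAt-removeAt; ∷-injectiveʳ)
open import Function using (_∘_)
open import Relation.Binary.PropositionalEquality
open import Relation.Nullary using (Dec; yes; no; contradiction)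

-- Sums over indices and over subsets, indicators.

sumFin-mono : ∀ n {f g : Fin n → ℕ} → (∀ i → f i ≤ g i) → sumFin n f ≤ sumFin n g
sumFin-mono zero    f≤g = z≤n
sumFin-mono (suc n) f≤g = +-mono-≤ (f≤g zero) (sumFin-mono n (f≤g ∘ suc))

sumFin-cong : ∀ n {f g : Fin n → ℕ} → (∀ i → f i ≡ g i) → sumFin n f ≡ sumFin n g
sumFin-cong zero    f≡g = refl
sumFin-cong (suc n) f≡g = cong₂ _+_ (f≡g zero) (sumFin-cong n (f≡g ∘ suc))

sumFin-const : ∀ n c → sumFin n (λ _ → c) ≡ n * c
sumFin-const zero    c = refl
sumFin-const (suc n) c = cong (c +_) (sumFin-const n c)

sumSub : ∀ l → (Subset l → ℕ) → ℕ
sumSub zero    f = f []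
sumSub (suc l) f = sumSub l (λ E → f (outside ∷ E) + f (inside ∷ E))

sumSub-mono : ∀ l {f g : Subset l → ℕ} → (∀ E → f E ≤ g E) → sumSub l f ≤ sumSub l g
sumSub-mono zero    f≤g = f≤g []
sumSub-mono (suc l) f≤g = sumSub-mono l (λ E → +-mono-≤ (f≤g _) (f≤g _))

sumSub-cong : ∀ l {f g : Subset l → ℕ} → (∀ E → f E ≡ g E) → sumSub l f ≡ sumSub l g
sumSub-cong zero    f≡g = f≡g []
sumSub-cong (suc l) f≡g = sumSub-cong l (λ E → cong₂ _+_ (f≡g _) (f≡g _))

+-interchange : ∀ a b c d → (a + b) + (c + d) ≡ (a + c) + (b + d)
+-interchange = solve-∀

sumSub-+ : ∀ l (f g : Subset l → ℕ) → sumSub l (λ E → f E + g E) ≡ sumSub l f + sumSub l g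
sumSub-+ zero    f g = refl
sumSub-+ (suc l) f g = trans
  (sumSub-cong l (λ E → +-interchange (f (outside ∷ E)) (g (outside ∷ E)) (f (inside ∷ E)) (g (inside ∷ E))))
  (sumSub-+ l _ _)

sumSub-*ˡ : ∀ l c (f : Subset l → ℕ) → sumSub l (λ E → c * f E) ≡ c * sumSub l f
sumSub-*ˡ zero    c f = refl
sumSub-*ˡ (suc l) c f = trans
  (sumSub-cong l (λ E → sym (*-distribˡ-+ c (f (outside ∷ E)) (f (inside ∷ E)))))
  (sumSub-*ˡ l c _)

sumSub-*ʳ : ∀ l c (f : Subset l → ℕ) → sumSub l (λ E → f E * c) ≡ sumSub l f * c
sumSub-*ʳ l c f = trans (sumSub-cong l (λ E → *-comm (f E) c)) (trans (sumSub-*ˡ l c f) (*-comm c _))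

sumSub-0 : ∀ l → sumSub l (λ _ → 0) ≡ 0
sumSub-0 zero    = refl
sumSub-0 (suc l) = sumSub-0 l

sumSub-sumFin : ∀ l n (g : Subset l → Fin n → ℕ) →
  sumSub l (λ E → sumFin n (g E)) ≡ sumFin n (λ i → sumSub l (λ E → g E i))
sumSub-sumFin l zero    g = sumSub-0 l
sumSub-sumFin l (suc n) g = trans (sumSub-+ l _ _)
  (cong (sumSub l (λ E → g E zero) +_) (sumSub-sumFin l n (λ E → g E ∘ suc)))

sumSub-insertAt : ∀ l (y : Fin (suc l)) (f : Subset (suc l) → ℕ) →
  sumSub (suc l) f ≡ sumSub l (λ R → f (insertAt R y outside) + f (insertAt R y inside))
sumSub-insertAt l       zero    f = refl
sumSub-insertAt (suc l) (suc y) f = trans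
  (sumSub-insertAt l y (λ E → f (outside ∷ E) + f (inside ∷ E)))
  (sumSub-cong l λ R → +-interchange (f (outside ∷ insertAt R y outside)) _ _ _)

_≟ˢ_ : ∀ {l} (E F : Subset l) → Dec (E ≡ F)
_≟ˢ_ = ≡-dec Bool._≟_

infix 4 _≟ˢ_

χ : ∀ {P : Set} → Dec P → ℕ → ℕ
χ (yes _) x = x
χ (no _)  x = 0

χ-no : ∀ {P : Set} (d : Dec P) {x} → (P → x ≡ 0) → χ d x ≡ 0
χ-no (yes p) h = h p
χ-no (no _)  h = refl

χ-cong : ∀ {P Q : Set} (d : Dec P) (d′ : Dec Q) → (P → Q) → (Q → P) → ∀ x → χ d x ≡ χ d′ x
χ-cong (yes p) (yes q) f g x = refl
χ-cong (yes p) (no ¬q) f g x = contradiction (f p) ¬q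
χ-cong (no ¬p) (yes q) f g x = contradiction (g q) ¬p
χ-cong (no _)  (no _)  f g x = refl

sumSub-χ : ∀ l (F : Subset l) x → sumSub l (λ E → χ (E ≟ˢ F) x) ≡ x
sumSub-χ zero    []            x = refl
sumSub-χ (suc l) (false ∷ F) x = trans
  (sumSub-cong l (λ E → cong₂ _+_
    (χ-cong (outside ∷ E ≟ˢ outside ∷ F) (E ≟ˢ F) ∷-injectiveʳ (cong (outside ∷_)) x)
    (χ-no (inside ∷ E ≟ˢ outside ∷ F) {x} (λ ()))))
  (trans (sumSub-cong l (λ E → +-identityʳ _)) (sumSub-χ l F x))
sumSub-χ (suc l) (true ∷ F)  x = trans
  (sumSub-cong l (λ E → cong₂ _+_
    (χ-no (outside ∷ E ≟ˢ inside ∷ F) {x} (λ ()))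
    (χ-cong (inside ∷ E ≟ˢ inside ∷ F) (E ≟ˢ F) ∷-injectiveʳ (cong (inside ∷_)) x)))
  (sumSub-χ l F x)

-- Subsets split at a coordinate.

bit : Bool → ℕ
bit b = if b then 1 else 0

∣∷∣ : ∀ {l} b (E : Subset l) → ∣ b ∷ E ∣ ≡ bit b + ∣ E ∣
∣∷∣ true  E = refl
∣∷∣ false E = refl

∣insertAt∣ : ∀ {l} (R : Subset l) y b → ∣ insertAt R y b ∣ ≡ bit b + ∣ R ∣
∣insertAt∣ R           zero    b = ∣∷∣ b R
∣insertAt∣ (true ∷ R)  (suc y) b = trans (cong suc (∣insertAt∣ R y b)) (sym (+-suc (bit b) ∣ R ∣))
∣insertAt∣ (false ∷ R) (suc y) b = ∣insertAt∣ R y b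

insertAt-∩ : ∀ {l} (R R′ : Subset l) y b b′ →
  insertAt R y b ∩ insertAt R′ y b′ ≡ insertAt (R ∩ R′) y (b ∧ b′)
insertAt-∩ R       R′       zero    b b′ = refl
insertAt-∩ (_ ∷ R) (_ ∷ R′) (suc y) b b′ = cong (_ ∷_) (insertAt-∩ R R′ y b b′)

∣insertAt-∩∣ : ∀ {l} (R R′ : Subset l) y b b′ →
  ∣ insertAt R y b ∩ insertAt R′ y b′ ∣ ≡ bit (b ∧ b′) + ∣ R ∩ R′ ∣
∣insertAt-∩∣ R R′ y b b′ = trans (cong ∣_∣ (insertAt-∩ R R′ y b b′)) (∣insertAt∣ (R ∩ R′) y (b ∧ b′))

-- A view: matching on it exhibits a subset as `insertAt R y b`, so that its size, its intersections
-- and its shift can be rewritten in terms of `R` and `b`.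
data SplitAt {l} (y : Fin (suc l)) : Subset (suc l) → Set where
  ins : ∀ R b → SplitAt y (insertAt R y b)

splitAt : ∀ {l} (y : Fin (suc l)) E → SplitAt y E
splitAt y E = subst (SplitAt y) (insertAt-removeAt E y) (ins (removeAt E y) (lookup E y))

sumFin-lookup : ∀ {l} (E : Subset l) p q →
  sumFin l (λ x → if lookup E x then p else q) ≡ ∣ E ∣ * p + (l ∸ ∣ E ∣) * q
sumFin-lookup []          p q = refl
sumFin-lookup (true ∷ E)  p q = trans (cong (p +_) (sumFin-lookup E p q)) (sym (+-assoc p _ _))
sumFin-lookup {suc l} (false ∷ E) p q
  rewrite +-∸-assoc 1 (∣p∣≤n E) = trans (cong (q +_) (sumFin-lookup E p q)) (arith q (∣ E ∣ * p) _)
  where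
  arith : ∀ a b c → a + (b + c) ≡ b + (a + c)
  arith = solve-∀

-- Valid level functions.

-- Levels are encoded as 0 for an absent set and suc s for a set of level s.
Compat : ℕ → ℕ → ℕ → Set
Compat a b r = 0 < a → 0 < b → a ⊔ b ≤ suc r

-- The case `E = F` is included: a present set has at least as many elements as its level.
Valid : ∀ {l} → (Subset l → ℕ) → Set
Valid σ = ∀ E F → Compat (σ E) (σ F) ∣ E ∩ F ∣

compat-sym : ∀ {a b r} → Compat a b r → Compat b a r
compat-sym {a} {b} c b>0 a>0 = ≤-trans (≤-reflexive (⊔-comm b a)) (c a>0 b>0)

compat-≤ : ∀ {a a′ b r} → a ≤ a′ → Compat a′ b r → Compat a b r
compat-≤ {b = b} a≤a′ c a>0 b>0 = ≤-trans (⊔-monoˡ-≤ b a≤a′) (c (≤-trans a>0 a≤a′) b>0)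

-- The maximum is one of its two arguments, so the positivity premise passes to the argument that
-- attains it.
compat-⊔ : ∀ {a a′ b r} → Compat a b r → Compat a′ b r → Compat (a ⊔ a′) b r
compat-⊔ {a} {a′} c c′ with ⊔-sel a a′
... | inj₁ eq rewrite eq = c
... | inj₂ eq rewrite eq = c′

compat-mono : ∀ {a b r r′} → r ≤ r′ → Compat a b r → Compat a b r′
compat-mono r≤r′ c a>0 b>0 = ≤-trans (c a>0 b>0) (s≤s r≤r′)

-- Shifting the point 0.

-- The two arguments tell whether a set contains 0 and whether it contains the target point. Of the
-- two sets containing exactly one of these points, the one with the target point receives the
-- larger value.
swap : (Bool → Bool → ℕ) → Bool → Bool → ℕ
swap τ true  true  = τ true true
swap τ true  false = τ true false ⊓ τ false true
swap τ false true  = τ false true ⊔ τ true false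
swap τ false false = τ false false

-- `c` counts the common points apart from the two coordinates of the shift. Each new value is a
-- minimum or a maximum of old ones, so every case reduces to old pairs that meet in at most as many
-- points as the new pair.
swap-compat : ∀ τ τ′ c →
  (∀ h b h′ b′ → Compat (τ h b) (τ′ h′ b′) (bit (h ∧ h′) + (bit (b ∧ b′) + c))) →
  ∀ h b h′ b′ → Compat (swap τ h b) (swap τ′ h′ b′) (bit (h ∧ h′) + (bit (b ∧ b′) + c))
swap-compat τ τ′ c ok true true true true = ok _ _ _ _
swap-compat τ τ′ c ok true true false false = ok _ _ _ _
swap-compat τ τ′ c ok false false true true = ok _ _ _ _
swap-compat τ τ′ c ok false false false false = ok _ _ _ _
swap-compat τ τ′ c ok true true true false = compat-sym (compat-≤ (m⊓n≤m _ _) (compat-sym (ok _ _ _ _)))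
swap-compat τ τ′ c ok false false true false = compat-sym (compat-≤ (m⊓n≤m _ _) (compat-sym (ok _ _ _ _)))
swap-compat τ τ′ c ok true false true true = compat-≤ (m⊓n≤m _ _) (ok _ _ _ _)
swap-compat τ τ′ c ok true false false false = compat-≤ (m⊓n≤m _ _) (ok _ _ _ _)
swap-compat τ τ′ c ok true false true false =
  compat-≤ (m⊓n≤m _ _) (compat-sym (compat-≤ (m⊓n≤m _ _) (compat-sym (ok true false true false))))
swap-compat τ τ′ c ok true true false true =
  compat-sym (compat-⊔ (compat-sym (ok true true false true)) (compat-sym (ok true true true false)))
swap-compat τ τ′ c ok false false false true =
  compat-sym (compat-⊔ (compat-sym (ok false false false true)) (compat-sym (ok false false true false)))
swap-compat τ τ′ c ok false true true true = compat-⊔ (ok false true true true) (ok true false true true)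
swap-compat τ τ′ c ok false true false false = compat-⊔ (ok false true false false) (ok true false false false)
-- Each candidate for the maximum is played against the argument of the minimum at the opposite
-- position, where the intersection is again `c`.
swap-compat τ τ′ c ok true false false true = compat-sym (compat-⊔
  (compat-sym (compat-≤ (m⊓n≤m _ _) (ok true false false true)))
  (compat-sym (compat-≤ (m⊓n≤n (τ true false) _) (ok false true true false))))
swap-compat τ τ′ c ok false true true false = compat-⊔
  (compat-sym (compat-≤ (m⊓n≤m _ _) (compat-sym (ok false true true false))))
  (compat-sym (compat-≤ (m⊓n≤n (τ′ true false) _) (compat-sym (ok true false false true))))
-- Both sets contain the target point, so there is one common point to spare for the two mixed
-- pairs, which only meet in `c`.
swap-compat τ τ′ c ok false true false true = compat-⊔
  (compat-sym (compat-⊔ (compat-sym (ok false true false true)) (compat-mono (n≤1+n c) (compat-sym (ok false true true false)))))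
  (compat-sym (compat-⊔ (compat-mono (n≤1+n c) (compat-sym (ok true false false true))) (compat-sym (ok true false true false))))

-- The shift of coordinate 0 to coordinate suc y, applied to every upper level set of σ.
shift : ∀ {l} → Fin (suc l) → (Subset (2 + l) → ℕ) → Subset (2 + l) → ℕ
shift y σ (h ∷ E) = swap (λ h b → σ (h ∷ insertAt (removeAt E y) y b)) h (lookup E y)

shift-insertAt : ∀ {l} y (σ : Subset (2 + l) → ℕ) h R b →
  shift y σ (h ∷ insertAt R y b) ≡ swap (λ h b → σ (h ∷ insertAt R y b)) h b
shift-insertAt y σ h R b rewrite insertAt-lookup R y b | removeAt-insertAt R y b = refl

shift-valid : ∀ {l} y (σ : Subset (2 + l) → ℕ) → Valid σ → Valid (shift y σ)
shift-valid y σ valid (h ∷ E) (h′ ∷ F) with splitAt y E | splitAt y F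
... | ins R b | ins R′ b′
  rewrite shift-insertAt y σ h R b | shift-insertAt y σ h′ R′ b′
  = subst (Compat _ _) (sym (size h b h′ b′)) (swap-compat _ _ ∣ R ∩ R′ ∣ (λ h b h′ b′ → subst (Compat _ _) (size h b h′ b′) (valid _ _)) h b h′ b′)
  where
  size : ∀ h b h′ b′ → ∣ (h ∷ insertAt R y b) ∩ (h′ ∷ insertAt R′ y b′) ∣ ≡ bit (h ∧ h′) + (bit (b ∧ b′) + ∣ R ∩ R′ ∣)
  size h b h′ b′ = trans (∣∷∣ (h ∧ h′) (insertAt R y b ∩ insertAt R′ y b′)) (cong (bit (h ∧ h′) +_) (∣insertAt-∩∣ R R′ y b b′))

shift-inside : ∀ {l} y (σ : Subset (2 + l) → ℕ) E → shift y σ (inside ∷ E) ≤ σ (inside ∷ E)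
shift-inside y σ E with splitAt y E
... | ins R true  rewrite shift-insertAt y σ true R true  = ≤-refl
... | ins R false rewrite shift-insertAt y σ true R false = m⊓n≤m _ _

shift-outside : ∀ {l} y (σ : Subset (2 + l) → ℕ) E → σ (outside ∷ E) ≤ shift y σ (outside ∷ E)
shift-outside y σ E with splitAt y E
... | ins R true  rewrite shift-insertAt y σ false R true  = m≤m⊔n _ _
... | ins R false rewrite shift-insertAt y σ false R false = ≤-refl

-- Equivalently, shifting 0 to `x` leaves `σ` unchanged.
Stable : ∀ {l} → (Subset (2 + l) → ℕ) → Fin (suc l) → Set
Stable σ x = ∀ R → σ (inside ∷ insertAt R x outside) ≤ σ (outside ∷ insertAt R x inside)

shift-stable : ∀ {l} y (σ : Subset (2 + l) → ℕ) → Stable (shift y σ) y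
shift-stable y σ R rewrite shift-insertAt y σ true R false | shift-insertAt y σ false R true =
  ≤-trans (m⊓n≤n _ _) (m≤m⊔n _ _)

-- Every shift lowers values only on sets with 0 and raises them only on sets without 0. Hence later
-- shifts do not spoil earlier ones, and one pass over all coordinates suffices.
shift-preserves-stable : ∀ {l} y (σ : Subset (2 + l) → ℕ) x → Stable σ x → Stable (shift y σ) x
shift-preserves-stable y σ x st R =
  ≤-trans (shift-inside y σ _) (≤-trans (st R) (shift-outside y σ _))

⊓+⊔ : ∀ (g : ℕ → ℕ) a b → g (a ⊓ b) + g (b ⊔ a) ≡ g a + g b
⊓+⊔ g a b with ≤-total a b
... | inj₁ a≤b rewrite m≤n⇒m⊓n≡m a≤b | m≥n⇒m⊔n≡m a≤b = refl
... | inj₂ b≤a rewrite m≥n⇒m⊓n≡n b≤a | m≤n⇒m⊔n≡n b≤a = +-comm (g b) (g a)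

-- The two sets that may exchange values have the same size and hence the same factor `v`; minimum
-- and maximum only rearrange their values.
shift-sum : ∀ {l} y (σ : Subset (2 + l) → ℕ) (ω v : ℕ → ℕ) →
  sumSub (2 + l) (λ E → ω (shift y σ E) * v ∣ E ∣) ≡ sumSub (2 + l) (λ E → ω (σ E) * v ∣ E ∣)
shift-sum {l} y σ ω v = trans (sumSub-insertAt l y (slice (shift y σ)))
  (trans (sumSub-cong l pointwise) (sym (sumSub-insertAt l y (slice σ))))
  where
  slice : (Subset (2 + l) → ℕ) → Subset (suc l) → ℕ
  slice τ E = ω (τ (outside ∷ E)) * v ∣ outside ∷ E ∣ + ω (τ (inside ∷ E)) * v ∣ inside ∷ E ∣
  regroup : ∀ a b c d r → (a + b * r) + (c * r + d) ≡ a + (b + c) * r + d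
  regroup = solve-∀
  swap-inner : ∀ a p q d r → (a + ω (p ⊓ q) * r) + (ω (q ⊔ p) * r + d) ≡ (a + ω p * r) + (ω q * r + d)
  swap-inner a p q d r = trans (regroup a (ω (p ⊓ q)) (ω (q ⊔ p)) d r)
    (trans (cong (λ z → a + z * r + d) (⊓+⊔ ω p q)) (sym (regroup a (ω p) (ω q) d r)))
  pointwise : ∀ R → slice (shift y σ) (insertAt R y outside) + slice (shift y σ) (insertAt R y inside)
                  ≡ slice σ (insertAt R y outside) + slice σ (insertAt R y inside)
  pointwise R
    rewrite shift-insertAt y σ true R true | shift-insertAt y σ true R false
          | shift-insertAt y σ false R true | shift-insertAt y σ false R false
          | ∣insertAt∣ R y true | ∣insertAt∣ R y false
    = swap-inner (ω (σ (false ∷ insertAt R y false)) * v ∣ R ∣)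
        (σ (true ∷ insertAt R y false)) (σ (false ∷ insertAt R y true))
        (ω (σ (true ∷ insertAt R y true)) * v (2 + ∣ R ∣)) (v (1 + ∣ R ∣))

-- Counting extensions to `k`-sets.

-- ext k N e is the number of k-sets extending a given e-set by elements of a disjoint N-set.
ext : ℕ → ℕ → ℕ → ℕ
ext k zero    e = χ (e ≟ k) 1
ext k (suc N) e = ext k N e + ext k N (suc e)

ext-large : ∀ k N {e} → k < e → ext k N e ≡ 0
ext-large k zero    {e} k<e = χ-no (e ≟ k) (λ e≡k → contradiction k<e (<-irrefl (sym e≡k)))
ext-large k (suc N) k<e rewrite ext-large k N k<e = ext-large k N (m<n⇒m<1+n k<e)

ext-binomial : ∀ e d N → ext (e + d) N e ≡ N C d
ext-binomial e zero zero rewrite +-identityʳ e with e ≟ e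
... | yes _  = refl
... | no e≢e = contradiction refl e≢e
ext-binomial e (suc d) zero = χ-no (e ≟ e + suc d) (λ eq → contradiction (trans eq (+-suc e d)) (m≢1+m+n e))
ext-binomial e zero (suc N)
  rewrite ext-binomial e zero N | ext-large (e + 0) N {suc e} (s≤s (≤-reflexive (+-identityʳ e))) = refl
ext-binomial e (suc d) (suc N) = trans
  (cong₂ _+_ (ext-binomial e (suc d) N)
             (trans (cong (λ z → ext z N (suc e)) (+-suc e d)) (ext-binomial (suc e) d N)))
  (trans (+-comm (N C suc d) _) (nCk+nC[k+1]≡[n+1]C[k+1] N d))

ext-∸ : ∀ {k e} N → e ≤ k → ext k N e ≡ N C (k ∸ e)
ext-∸ {k} {e} N e≤k = trans (cong (λ z → ext z N e) (sym (m+[n∸m]≡n e≤k))) (ext-binomial e (k ∸ e) N)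

-- The absorption identity d C(N+1, d) = (N+1) C(N, d-1): both sides count extensions with one added
-- element marked.
ext-absorb : ∀ N e d → ext (e + d) (suc N) e * d ≡ suc N * ext (e + d) N (suc e)
ext-absorb N e zero
  rewrite ext-large (e + 0) N {suc e} (s≤s (≤-reflexive (+-identityʳ e))) = trans (*-zeroʳ (ext (e + 0) N e + 0)) (sym (*-zeroʳ N))
ext-absorb zero e (suc zero) rewrite +-comm e 1 with e ≟ suc e | suc e ≟ suc e
... | yes eq | _ = contradiction eq (m≢1+m+n e ∘ λ z → trans z (cong suc (sym (+-identityʳ e))))
... | no _ | yes _ = refl
... | no _ | no ne = contradiction refl ne
ext-absorb zero e (suc (suc d))
  rewrite ext-binomial e (2 + d) 0 | +-suc e (suc d) | ext-binomial (suc e) (suc d) 0 = refl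
ext-absorb (suc N) e (suc d) = begin-equality
  (X + Y) * suc d                  ≡⟨ arith X Y d ⟩
  X * suc d + (Y * d + Y)          ≡⟨ cong₂ (λ x y → x + (y + Y)) (ext-absorb N e (suc d)) ih ⟩
  -- The last summand `Y` unfolds to `P + Q`.
  suc N * P + (suc N * Q + (P + Q)) ≡⟨ arith′ (suc N) P Q ⟩
  suc (suc N) * (P + Q)            ∎
  where
  open ≤-Reasoning
  k = e + suc d
  X = ext k (suc N) e
  Y = ext k (suc N) (suc e)
  P = ext k N (suc e)
  Q = ext k N (suc (suc e))
  ih : Y * d ≡ suc N * Q
  ih = subst (λ z → ext z (suc N) (suc e) * d ≡ suc N * ext z N (2 + e)) (sym (+-suc e d)) (ext-absorb N (suc e) d)
  arith : ∀ x y d → (x + y) * suc d ≡ x * suc d + (y * d + y)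
  arith = solve-∀
  arith′ : ∀ n p q → n * p + (n * q + (p + q)) ≡ suc n * (p + q)
  arith′ = solve-∀

-- Adding d * ext (suc e) to both sides turns this into the absorption identity.
ext-ratio : ∀ N P e u d → N + suc (e + u) ≡ P + (e + d) →
  ext (e + d) N e * d + ext (e + d) N (suc e) * u ≡ P * ext (e + d) N (suc e)
ext-ratio N P e u d eq = +-cancelˡ-≡ (y * d) _ _ (begin-equality
  y * d + (x * d + y * u)  ≡⟨ arith x y d u ⟩
  (x + y) * d + u * y      ≡⟨ cong (_+ u * y) (ext-absorb N e d) ⟩
  suc N * y + u * y        ≡⟨ *-distribʳ-+ y (suc N) u ⟨
  (suc N + u) * y          ≡⟨ cong (_* y) 1+N+u≡P+d ⟩
  (P + d) * y              ≡⟨ arith′ P d y ⟩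
  y * d + P * y            ∎)
  where
  open ≤-Reasoning
  x = ext (e + d) N e
  y = ext (e + d) N (suc e)
  arith : ∀ x y d u → y * d + (x * d + y * u) ≡ (x + y) * d + u * y
  arith = solve-∀
  arith′ : ∀ P d y → (P + d) * y ≡ y * d + P * y
  arith′ = solve-∀
  left : ∀ N e u → e + (suc N + u) ≡ N + suc (e + u)
  left = solve-∀
  right : ∀ P e d → P + (e + d) ≡ e + (P + d)
  right = solve-∀
  1+N+u≡P+d : suc N + u ≡ P + d
  1+N+u≡P+d = +-cancelˡ-≡ e _ _ (trans (left N e u) (trans eq (right P e d)))

-- Numerical estimates.

4ab≤[a+b]² : ∀ a b → 4 * (a * b) ≤ (a + b) * (a + b)
4ab≤[a+b]² a b = [ ordered , subst₂ _≤_ (cong (4 *_) (*-comm b a)) (cong₂ _*_ (+-comm b a) (+-comm b a)) ∘ ordered ]′ (≤-total a b)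
  where
  expand : ∀ a c → 4 * (a * (a + c)) + c * c ≡ (a + (a + c)) * (a + (a + c))
  expand = solve-∀
  ordered : ∀ {a b} → a ≤ b → 4 * (a * b) ≤ (a + b) * (a + b)
  ordered {a} {b} a≤b = subst (λ b → 4 * (a * b) ≤ (a + b) * (a + b)) (m+[n∸m]≡n a≤b)
    (m+n≤o⇒m≤o _ (≤-reflexive (expand a (b ∸ a))))

-- u (P - u) ≥ P - 1 for 1 ≤ u < P
u²+P≤uP+1 : ∀ {u P} → 1 ≤ u → u < P → u * u + P ≤ u * P + 1
u²+P≤uP+1 {suc u} {P} _ u<P = subst (λ P → suc u * suc u + P ≤ suc u * P + 1) (m+[n∸m]≡n u<P)
  (m+n≤o⇒m≤o _ (≤-reflexive (expand u (P ∸ suc (suc u)))))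
  where
  expand : ∀ u p → (suc u * suc u + (suc (suc u) + p)) + u * p ≡ suc u * (suc (suc u) + p) + 1
  expand = solve-∀

4L[k∸L]≤k² : ∀ k L → 4 * (L * (k ∸ L)) ≤ k * k
4L[k∸L]≤k² k L with ≤-total L k
... | inj₁ L≤k = subst (λ z → 4 * (L * (k ∸ L)) ≤ z * z) (m+[n∸m]≡n L≤k) (4ab≤[a+b]² L (k ∸ L))
... | inj₂ k≤L rewrite m≤n⇒m∸n≡0 k≤L | *-zeroʳ L = z≤n

-- The one inequality behind both averaging arguments: `P * (e * d + u * u)` pays for sets other
-- than the full one, `L * (k ∸ L) * d` for the full set. The `4 * P` added to both sides absorbs
-- the 1 in `u²+P≤uP+1`.
key-estimate : ∀ {P L} e u d → let k = e + d in
  e + u ≡ L → 1 ≤ u → L + 2 ≤ 2 * k → k * k + 12 * k ≤ 4 * P →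
  L * (k ∸ L) * d + P * (e * d + u * u) ≤ P * (u * P)
key-estimate {P} {L} e u d e+u≡L 1≤u L+2≤2k large = *-cancelˡ-≤ 4 (+-cancelʳ-≤ (4 * P) _ _ (begin
  4 * (L * (k ∸ L) * d + P * (e * d + u * u)) + 4 * P
    ≡⟨ regroup (L * (k ∸ L)) d P (e * d) (u * u) ⟩
  4 * (L * (k ∸ L)) * d + P * (4 * (e * d)) + P * 4 + 4 * P * (u * u)
    ≤⟨ +-monoˡ-≤ _ (+-mono-≤ (+-mono-≤ (*-mono-≤ (4L[k∸L]≤k² k L) (m≤n+m d e)) (*-monoʳ-≤ P (4ab≤[a+b]² e d))) (*-monoʳ-≤ P (*-monoʳ-≤ 4 1≤k))) ⟩
  k * k * k + P * (k * k) + P * (4 * k) + 4 * P * (u * u)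
    ≤⟨ +-monoˡ-≤ _ (+-monoˡ-≤ _ (+-monoˡ-≤ _ k³≤)) ⟩
  k * (4 * P) + P * (k * k) + P * (4 * k) + 4 * P * (u * u)
    -- The `12 * k` of the hypothesis is made of three terms `4 * k`: one from the cube of `k`, one
    -- from the added `4 * P`, and this spare one.
    ≤⟨ m≤m+n _ (P * (4 * k)) ⟩
  k * (4 * P) + P * (k * k) + P * (4 * k) + 4 * P * (u * u) + P * (4 * k)
    ≡⟨ collect k P (u * u) ⟩
  P * (k * k + 12 * k) + 4 * P * (u * u)
    ≤⟨ +-monoˡ-≤ _ (*-monoʳ-≤ P large) ⟩
  P * (4 * P) + 4 * P * (u * u)
    ≡⟨ factor P (u * u) ⟩
  4 * P * (u * u + P)
    ≤⟨ *-monoʳ-≤ (4 * P) (u²+P≤uP+1 1≤u u<P) ⟩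
  4 * P * (u * P + 1)
    ≡⟨ expand P (u * P) ⟩
  4 * (P * (u * P)) + 4 * P ∎))
  where
  open ≤-Reasoning
  k = e + d
  regroup : ∀ a d P x y → 4 * (a * d + P * (x + y)) + 4 * P ≡ 4 * a * d + P * (4 * x) + P * 4 + 4 * P * y
  regroup = solve-∀
  collect : ∀ k P y → k * (4 * P) + P * (k * k) + P * (4 * k) + 4 * P * y + P * (4 * k) ≡ P * (k * k + 12 * k) + 4 * P * y
  collect = solve-∀
  factor : ∀ P y → P * (4 * P) + 4 * P * y ≡ 4 * P * (y + P)
  factor = solve-∀
  expand : ∀ P x → 4 * P * (x + 1) ≡ 4 * (P * x) + 4 * P
  expand = solve-∀
  double : ∀ k → 4 * (2 * k) + 4 * k ≡ 12 * k
  double = solve-∀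
  1≤k : 1 ≤ k
  1≤k = n≢0⇒n>0 λ k≡0 → contradiction (m+n≤o⇒n≤o L (subst (λ z → L + 2 ≤ 2 * z) k≡0 L+2≤2k)) λ ()
  k³≤ : k * k * k ≤ k * (4 * P)
  k³≤ = ≤-trans (≤-reflexive (*-assoc k k k)) (*-monoʳ-≤ k (m+n≤o⇒m≤o (k * k) large))
  u<P : u < P
  u<P = *-cancelˡ-≤ 4 (begin
    4 * suc u          ≤⟨ *-monoʳ-≤ 4 (s≤s (≤-trans (m≤n+m u e) (≤-reflexive e+u≡L))) ⟩
    4 * suc L          ≤⟨ *-monoʳ-≤ 4 (≤-trans (n≤1+n (suc L)) (≤-reflexive (+-comm 2 L))) ⟩
    4 * (L + 2)        ≤⟨ *-monoʳ-≤ 4 L+2≤2k ⟩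
    4 * (2 * k)        ≤⟨ m+n≤o⇒m≤o (4 * (2 * k)) (≤-reflexive (double k)) ⟩
    12 * k             ≤⟨ m+n≤o⇒n≤o (k * k) large ⟩
    4 * P              ∎)

-- Largest value, common missing points, and shifting to all points.

argmax : ∀ l (σ : Subset l → ℕ) → ∃ λ G → ∀ F → σ F ≤ σ G
argmax zero    σ = [] , λ { [] → ≤-refl }
argmax (suc l) σ with argmax l (σ ∘ (outside ∷_)) | argmax l (σ ∘ (inside ∷_))
... | G , G-max | H , H-max with ≤-total (σ (outside ∷ G)) (σ (inside ∷ H))
...   | inj₁ G≤H = inside ∷ H , λ { (false ∷ F) → ≤-trans (G-max F) G≤H ; (true ∷ F) → H-max F }
...   | inj₂ H≤G = outside ∷ G , λ { (false ∷ F) → G-max F ; (true ∷ F) → ≤-trans (H-max F) H≤G }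

common-missing : ∀ {l} (E F : Subset l) → ∣ E ∣ + ∣ F ∣ < l →
  ∃ λ x → lookup E x ≡ outside × lookup F x ≡ outside
common-missing (false ∷ E) (false ∷ F) _ = zero , refl , refl
common-missing (true ∷ E)  (false ∷ F) (s≤s lt) with common-missing E F lt
... | x , x∉E , x∉F = suc x , x∉E , x∉F
common-missing (false ∷ E) (true ∷ F)  (s≤s lt) with common-missing E F (≤-trans (≤-reflexive (sym (+-suc ∣ E ∣ ∣ F ∣))) lt)
... | x , x∉E , x∉F = suc x , x∉E , x∉F
common-missing (true ∷ E)  (true ∷ F)  (s≤s lt) with common-missing E F (≤-trans (s≤s (+-monoʳ-≤ ∣ E ∣ (n≤1+n ∣ F ∣))) lt)
... | x , x∉E , x∉F = suc x , x∉E , x∉F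

shift-all : ∀ {l} (xs : List (Fin (suc l))) (σ : Subset (2 + l) → ℕ) → Valid σ →
  ∃ λ τ → Valid τ × (∀ x → x ∈ xs → Stable τ x) ×
    (∀ (ω v : ℕ → ℕ) → sumSub (2 + l) (λ E → ω (τ E) * v ∣ E ∣) ≡ sumSub (2 + l) (λ E → ω (σ E) * v ∣ E ∣))
shift-all []       σ valid = σ , valid , (λ _ ()) , λ _ _ → refl
shift-all (y ∷ xs) σ valid with shift-all xs σ valid
... | τ , τ-valid , τ-stable , τ-sum = shift y τ , shift-valid y τ τ-valid ,
  (λ { x (here refl) → shift-stable y τ ; x (there x∈xs) → shift-preserves-stable y τ x (τ-stable x x∈xs) }) ,
  λ ω v → trans (shift-sum y τ ω v) (τ-sum ω v)

-- Removing the point 0.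

-- Exchange 0 for `x` in the first set. By stability its level does not drop, and the new set meets
-- `F` together with 0 in exactly `E ∩ F`.
lifted-compat : ∀ {l} (σ : Subset (2 + l) → ℕ) → Valid σ → ∀ x → Stable σ x → ∀ E F →
  lookup E x ≡ outside → lookup F x ≡ outside → Compat (σ (inside ∷ E)) (σ (inside ∷ F)) ∣ E ∩ F ∣
lifted-compat σ valid x stable E F x∉E x∉F with splitAt x E | splitAt x F
... | ins R b | ins R′ b′
  rewrite trans (sym (insertAt-lookup R x b)) x∉E | trans (sym (insertAt-lookup R′ x b′)) x∉F
  = compat-≤ (stable R) (subst (Compat _ _)
      (trans (∣insertAt-∩∣ R R′ x inside outside) (sym (∣insertAt-∩∣ R R′ x outside outside)))
      (valid (outside ∷ insertAt R x inside) (inside ∷ insertAt R′ x outside)))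

join : ∀ {l} → (Subset (suc l) → ℕ) → Subset l → ℕ
join σ E = σ (outside ∷ E) ⊔ σ (inside ∷ E)

-- Of the four pairs compared, only the pair with 0 in both sets loses a common point when 0 is
-- removed; that pair is the hypothesis.
join-compat : ∀ {l} (σ : Subset (suc l) → ℕ) → Valid σ → ∀ E F →
  Compat (σ (inside ∷ E)) (σ (inside ∷ F)) ∣ E ∩ F ∣ → Compat (join σ E) (join σ F) ∣ E ∩ F ∣
join-compat σ valid E F both = compat-⊔
  (compat-sym (compat-⊔ (compat-sym (valid (outside ∷ E) (outside ∷ F))) (compat-sym (valid (outside ∷ E) (inside ∷ F)))))
  (compat-sym (compat-⊔ (compat-sym (valid (inside ∷ E) (outside ∷ F))) (compat-sym both)))

join-compatʳ : ∀ {l} (σ : Subset (suc l) → ℕ) → Valid σ → ∀ E F →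
  Compat (σ (outside ∷ E)) (join σ F) ∣ E ∩ F ∣
join-compatʳ σ valid E F =
  compat-sym (compat-⊔ (compat-sym (valid (outside ∷ E) (outside ∷ F))) (compat-sym (valid (outside ∷ E) (inside ∷ F))))

∩-swap : ∀ {l} {a b} (E F : Subset l) → Compat a b ∣ F ∩ E ∣ → Compat b a ∣ E ∩ F ∣
∩-swap E F c = compat-sym (subst (Compat _ _) (cong ∣_∣ (∩-comm F E)) c)

-- For sets of size at least `k`, adding 0 gives more than `k` elements, so the level of
-- `inside ∷ E` carries no weight and may be discarded.
liftSmall : ∀ {l} → ℕ → (Subset (suc l) → ℕ) → Subset l → ℕ
liftSmall k σ E with ∣ E ∣ <? k
... | yes _ = join σ E
... | no _  = σ (outside ∷ E)

-- Two raised sets have together at most `2 * k` - 2 ≤ `l` elements, so one of the `suc l` remaining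
-- points misses both.
liftSmall-valid : ∀ {l} k (σ : Subset (2 + l) → ℕ) → Valid σ → (∀ x → Stable σ x) →
  2 * k ≤ 2 + l → Valid (liftSmall k σ)
liftSmall-valid {l} k σ valid stable 2k≤ E F with ∣ E ∣ <? k | ∣ F ∣ <? k
... | no _    | no _    = valid _ _
... | no _    | yes _   = join-compatʳ σ valid E F
... | yes _   | no _    = ∩-swap E F (join-compatʳ σ valid F E)
... | yes e<k | yes f<k = join-compat σ valid E F
  (lifted-compat σ valid (proj₁ miss) (stable _) E F (proj₁ (proj₂ miss)) (proj₂ (proj₂ miss)))
  where
  open ≤-Reasoning
  miss : ∃ λ x → lookup E x ≡ outside × lookup F x ≡ outside
  miss = common-missing E F (s≤s⁻¹ (begin
    suc (suc (∣ E ∣ + ∣ F ∣)) ≡⟨ cong suc (+-suc ∣ E ∣ ∣ F ∣) ⟨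
    suc ∣ E ∣ + suc ∣ F ∣     ≤⟨ +-mono-≤ e<k f<k ⟩
    k + k                     ≡⟨ cong (k +_) (+-identityʳ k) ⟨
    2 * k                     ≤⟨ 2k≤ ⟩
    2 + l                     ∎))

liftMissing : ∀ {l} → (Subset (suc l) → ℕ) → Fin l → Subset l → ℕ
liftMissing σ x E = if lookup E x then σ (outside ∷ E) else join σ E

-- Two raised sets both miss `x`. If at most one set of a pair is raised, 0 is never a common point
-- and nothing is lost.
liftMissing-valid : ∀ {l} (σ : Subset (2 + l) → ℕ) → Valid σ → ∀ x → Stable σ x → Valid (liftMissing σ x)
liftMissing-valid σ valid x stable E F with lookup E x in x∈E | lookup F x in x∈F
... | true  | true  = valid _ _
... | true  | false = join-compatʳ σ valid E F
... | false | true  = ∩-swap E F (join-compatʳ σ valid F E)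
... | false | false = join-compat σ valid E F (lifted-compat σ valid x stable E F x∈E x∈F)

-- The code `2 + e` is level `e` + 1. Sets of size `e` meet the full set in too few points for this
-- level and are made absent.
liftFull : ∀ {l} → ℕ → (Subset (suc l) → ℕ) → Fin l → Subset l → ℕ
liftFull e σ x E with E ≟ˢ ⊤ | ∣ E ∣ ≟ e
... | yes _ | _     = 2 + e
... | no _  | yes _ = 0
... | no _  | no _  = liftMissing σ x E

record Top {l} (σ : Subset l → ℕ) (e : ℕ) : Set where
  field
    σ≤  : ∀ E → σ E ≤ 2 + e
    <∣∣ : ∀ E → 0 < σ E → e < ∣ E ∣

module _ {l e} (σ : Subset (suc l) → ℕ) (top : Top σ e) where
  open Top top

  join≤ : ∀ E → join σ E ≤ 2 + e
  join≤ E = ⊔-lub (σ≤ _) (σ≤ _)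

  -- Removing 0 may cost one element, so after joining sizes start at `e` and no longer at `e` + 1.
  0<join⇒e≤∣∣ : ∀ E → 0 < join σ E → e ≤ ∣ E ∣
  0<join⇒e≤∣∣ E pos with ⊔-sel (σ (outside ∷ E)) (σ (inside ∷ E))
  ... | inj₁ eq = <⇒≤ (<∣∣ (outside ∷ E) (subst (0 <_) eq pos))
  ... | inj₂ eq = s≤s⁻¹ (<∣∣ (inside ∷ E) (subst (0 <_) eq pos))

  liftMissing≤ : ∀ x E → liftMissing σ x E ≤ 2 + e
  liftMissing≤ x E with lookup E x
  ... | true  = σ≤ _
  ... | false = join≤ E

  0<liftMissing⇒e≤∣∣ : ∀ x E → 0 < liftMissing σ x E → e ≤ ∣ E ∣
  0<liftMissing⇒e≤∣∣ x E with lookup E x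
  ... | true  = λ pos → <⇒≤ (<∣∣ _ pos)
  ... | false = 0<join⇒e≤∣∣ E

  liftFull-compat-⊤ : ∀ x F → e < l → ∣ F ∣ ≢ e → Compat (2 + e) (liftMissing σ x F) ∣ ⊤ ∩ F ∣
  liftFull-compat-⊤ x F e<l ∣F∣≢e _ pos = ≤-trans (⊔-lub ≤-refl (liftMissing≤ x F))
    (s≤s (≤-trans (≤∧≢⇒< (0<liftMissing⇒e≤∣∣ x F pos) (∣F∣≢e ∘ sym)) (≤-reflexive (cong ∣_∣ (sym (∩-identityˡ F))))))

  -- The full set has `l` > `e` points and meets any `F` in all of `F`. Once size `e` is dropped,
  -- each remaining present set has at least `e` + 1 elements.
  liftFull-valid : (∀ x → Valid (liftMissing σ x)) → e < l → ∀ x → Valid (liftFull e σ x)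
  liftFull-valid valid e<l x E F with E ≟ˢ ⊤ | ∣ E ∣ ≟ e | F ≟ˢ ⊤ | ∣ F ∣ ≟ e
  ... | no _     | no _    | no _     | no _   = valid x E F
  ... | no _     | yes _   | _        | _      = λ ()
  ... | yes _    | _       | no _     | yes _  = λ _ ()
  ... | no _     | no _    | no _     | yes _  = λ _ ()
  ... | yes refl | _       | yes refl | _      = λ _ _ → ≤-trans (≤-reflexive (⊔-idem (2 + e)))
    (s≤s (≤-trans e<l (≤-reflexive (sym (trans (cong ∣_∣ (∩-idem (⊤ {l}))) (∣⊤∣≡n l))))))
  ... | yes refl | _       | no _     | no f≢e = liftFull-compat-⊤ x F e<l f≢e
  ... | no _     | no e′≢e | yes refl | _      = ∩-swap E ⊤ (liftFull-compat-⊤ x E e<l e′≢e)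

-- A set of size `e` is raised from `a` to `b` for the `z` choices of `x` outside it. With
-- `b = a + δ` and `c` replaced by `b`, the gain is `δ * (z * v₀)` and the loss `δ * (e * v₁)`.
average-gain : ∀ e z a b c v₀ v₁ → a ≤ b → c ≤ b → e * v₁ ≤ z * v₀ →
  (e + z) * (a * v₀ + c * v₁) ≤ (e * a + z * b) * (v₀ + v₁)
average-gain e z a b c v₀ v₁ a≤b c≤b ev₁≤zv₀ = begin
  (e + z) * (a * v₀ + c * v₁)            ≤⟨ *-monoʳ-≤ (e + z) (+-monoʳ-≤ (a * v₀) (*-monoˡ-≤ v₁ c≤b)) ⟩
  (e + z) * (a * v₀ + b * v₁)            ≡⟨ cong (λ b → (e + z) * (a * v₀ + b * v₁)) (m+[n∸m]≡n a≤b) ⟨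
  (e + z) * (a * v₀ + (a + δ) * v₁)      ≡⟨ split e z a δ v₀ v₁ ⟩
  common + δ * (e * v₁)                  ≤⟨ +-monoʳ-≤ common (*-monoʳ-≤ δ ev₁≤zv₀) ⟩
  common + δ * (z * v₀)                  ≡⟨ split′ e z a δ v₀ v₁ ⟩
  (e * a + z * (a + δ)) * (v₀ + v₁)      ≡⟨ cong (λ b → (e * a + z * b) * (v₀ + v₁)) (m+[n∸m]≡n a≤b) ⟩
  (e * a + z * b) * (v₀ + v₁)            ∎
  where
  open ≤-Reasoning
  δ common : ℕ
  δ = b ∸ a
  common = (e + z) * (a * (v₀ + v₁)) + z * (δ * v₁)
  split : ∀ e z a δ v₀ v₁ →
    (e + z) * (a * v₀ + (a + δ) * v₁) ≡ (e + z) * (a * (v₀ + v₁)) + z * (δ * v₁) + δ * (e * v₁)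
  split = solve-∀
  split′ : ∀ e z a δ v₀ v₁ →
    (e + z) * (a * (v₀ + v₁)) + z * (δ * v₁) + δ * (z * v₀) ≡ (e * a + z * (a + δ)) * (v₀ + v₁)
  split′ = solve-∀

-- Weights and the terminal cases.

levelWeight : (ℕ → ℕ) → ℕ → ℕ
levelWeight w zero    = 0
levelWeight w (suc s) = w s

-- `P` stands for n - k. The premise `star-bound` says that `X` bounds the weight of each star, that
-- is, of all `k`-sets containing a fixed `s`-set.
module Pulling
  (k P X : ℕ) (large : 2 ≤ k → k * k + 12 * k ≤ 4 * P)
  (w : ℕ → ℕ) (w-mono : ∀ {s t} → s ≤ t → w s ≤ w t)
  (star-bound : ∀ s N → N + s ≡ P + k → w s * ext k N s ≤ X)
  where

  ω : ℕ → ℕ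
  ω = levelWeight w

  ω-mono : ∀ {a b} → a ≤ b → ω a ≤ ω b
  ω-mono z≤n       = z≤n
  ω-mono (s≤s a≤b) = w-mono a≤b

  -- The total weight of the `k`-subsets of `l` + `N` points when each is weighted by the level of
  -- its trace on the first `l` points.
  weight : ∀ N l → (Subset l → ℕ) → ℕ
  weight N l σ = sumSub l (λ E → ω (σ E) * ext k N ∣ E ∣)

  sumSub-ext : ∀ N l → sumSub l (λ E → ext k N ∣ E ∣) ≡ ext k (N + l) 0
  sumSub-ext N zero    = cong (λ z → ext k z 0) (sym (+-identityʳ N))
  sumSub-ext N (suc l) = trans (sumSub-ext (suc N) l) (cong (λ z → ext k z 0) (sym (+-suc N l)))

  level0-bound : ∀ N l σ → N + l ≡ P + k → (∀ E → σ E ≤ 1) → weight N l σ ≤ X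
  level0-bound N l σ N+l≡n σ≤1 = begin
    weight N l σ                            ≤⟨ sumSub-mono l (λ E → *-monoˡ-≤ (ext k N ∣ E ∣) (ω-mono (σ≤1 E))) ⟩
    sumSub l (λ E → w 0 * ext k N ∣ E ∣)    ≡⟨ sumSub-*ˡ l (w 0) _ ⟩
    w 0 * sumSub l (λ E → ext k N ∣ E ∣)    ≡⟨ cong (w 0 *_) (sumSub-ext N l) ⟩
    w 0 * ext k (N + l) 0                   ≤⟨ star-bound 0 (N + l) (trans (+-identityʳ (N + l)) N+l≡n) ⟩
    X                                       ∎
    where open ≤-Reasoning

  ⊤-only-bound : ∀ N l σ → N + l ≡ P + k → (∀ E → σ E ≤ suc l) → (∀ E → 0 < σ E → l ≤ ∣ E ∣) → weight N l σ ≤ X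
  ⊤-only-bound N l σ N+l≡n σ≤ present = begin
    weight N l σ                                       ≤⟨ sumSub-mono l pointwise ⟩
    sumSub l (λ E → χ (E ≟ˢ ⊤) (w l * ext k N l))      ≡⟨ sumSub-χ l ⊤ _ ⟩
    w l * ext k N l                                    ≤⟨ star-bound l N N+l≡n ⟩
    X                                                  ∎
    where
    open ≤-Reasoning
    pointwise : ∀ E → ω (σ E) * ext k N ∣ E ∣ ≤ χ (E ≟ˢ ⊤) (w l * ext k N l)
    pointwise E with E ≟ˢ ⊤
    ... | yes refl rewrite ∣⊤∣≡n l = *-monoˡ-≤ (ext k N l) (ω-mono (σ≤ ⊤))
    ... | no E≢⊤ with σ E in eq
    ...   | zero  = z≤n
    ...   | suc _ = contradiction (∣p∣≡n⇒p≡⊤ (≤-antisym (∣p∣≤n E) (present E (subst (0 <_) (sym eq) z<s)))) E≢⊤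

  -- A set `G` of largest level `e` + 1 meets every present set in at least `e` + 1 points. In
  -- particular `e` + 1 ≤ `l`, and equality leaves only the full set.
  extreme : ∀ N l σ → N + l ≡ P + k → Valid σ → weight N l σ ≤ X ⊎ ∃ λ e → suc e < l × Top σ e
  extreme N l σ N+l≡n valid with argmax l σ
  ... | G , G-max with σ G in σG
  ...   | zero        = inj₁ (level0-bound N l σ N+l≡n (λ E → ≤-trans (G-max E) z≤n))
  ...   | suc zero    = inj₁ (level0-bound N l σ N+l≡n G-max)
  ...   | suc (suc e) = by-size (m≤n⇒m<n∨m≡n (≤-trans (present G (subst (0 <_) (sym σG) z<s)) (∣p∣≤n G)))
    where
    present : ∀ F → 0 < σ F → e < ∣ F ∣
    present F pos = s≤s⁻¹ (≤-trans (≤-trans (≤-reflexive (sym σG)) (m≤m⊔n (σ G) (σ F)))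
      (≤-trans (valid G F (subst (0 <_) (sym σG) z<s) pos) (s≤s (∣p∩q∣≤∣q∣ G F))))
    by-size : suc e < l ⊎ suc e ≡ l → weight N l σ ≤ X ⊎ ∃ λ e → suc e < l × Top σ e
    by-size (inj₁ e<l)  = inj₂ (e , e<l , record { σ≤ = G-max ; <∣∣ = present })
    by-size (inj₂ refl) = inj₁ (⊤-only-bound N l σ N+l≡n G-max present)

  liftSmall-weight : ∀ N l (σ : Subset (suc l) → ℕ) → weight N (suc l) σ ≤ weight (suc N) l (liftSmall k σ)
  liftSmall-weight N l σ = sumSub-mono l pointwise
    where
    pointwise : ∀ E → ω (σ (outside ∷ E)) * ext k N ∣ E ∣ + ω (σ (inside ∷ E)) * ext k N (suc ∣ E ∣)
                    ≤ ω (liftSmall k σ E) * (ext k N ∣ E ∣ + ext k N (suc ∣ E ∣))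
    pointwise E with ∣ E ∣ <? k
    ... | yes _ = ≤-trans
      (+-mono-≤ (*-monoˡ-≤ (ext k N ∣ E ∣) (ω-mono (m≤m⊔n (σ (outside ∷ E)) _)))
                (*-monoˡ-≤ (ext k N (suc ∣ E ∣)) (ω-mono (m≤n⊔m (σ (outside ∷ E)) _))))
      (≤-reflexive (sym (*-distribˡ-+ (ω (join σ E)) (ext k N ∣ E ∣) _)))
    ... | no e≮k rewrite ext-large k N (s≤s (≮⇒≥ e≮k)) | *-zeroʳ (ω (σ (inside ∷ E))) =
      ≤-reflexive (trans (+-identityʳ _) (cong (ω (σ (outside ∷ E)) *_) (sym (+-identityʳ (ext k N ∣ E ∣)))))

  liftMissing-average : ∀ l (σ : Subset (suc l) → ℕ) E V →
    sumFin l (λ x → ω (liftMissing σ x E) * V) ≡ (∣ E ∣ * ω (σ (outside ∷ E)) + (l ∸ ∣ E ∣) * ω (join σ E)) * V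
  liftMissing-average l σ E V = trans (sumFin-cong l pointwise)
    (trans (sumFin-lookup E _ _) (arith ∣ E ∣ (ω (σ (outside ∷ E))) (l ∸ ∣ E ∣) (ω (join σ E)) V))
    where
    pointwise : ∀ x → ω (liftMissing σ x E) * V ≡ (if lookup E x then ω (σ (outside ∷ E)) * V else ω (join σ E) * V)
    pointwise x with lookup E x
    ... | true  = refl
    ... | false = refl
    arith : ∀ e a z b V → e * (a * V) + z * (b * V) ≡ (e * a + z * b) * V
    arith = solve-∀

  -- Averaging over the missing point.

  module Averaging
    (N l : ℕ) (N+l≡n : N + suc (suc l) ≡ P + k) (l≤2k : suc l + 2 ≤ 2 * k)
    (ih : ∀ τ → Valid τ → weight (suc N) (suc l) τ ≤ X)
    (σ : Subset (2 + l) → ℕ) (valid : Valid σ) (stable : ∀ x → Stable σ x)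
    (e : ℕ) (e<L : e < suc l) (top : Top σ e)
    where
    open Top top
    L u Δ S : ℕ
    L = suc l
    u = L ∸ e
    a c : Subset L → ℕ
    a E = ω (σ (outside ∷ E))
    c E = ω (σ (inside ∷ E))
    -- `Δ` measures how much `liftFull` raises the full set above its own weight without 0; `S` is
    -- the weight of the sets of size `e` that it gives up.
    Δ = w (suc e) ∸ a ⊤
    S = sumSub L (λ E → χ (∣ E ∣ ≟ e) (c E))
    v : ℕ → ℕ
    v = ext k N

    2≤k : 2 ≤ k
    -- Here 3 ≤ `suc l + 2` ≤ `2 * k`.
    2≤k = *-cancelˡ-< 2 1 k (≤-trans (s≤s (m≤n+m 2 l)) l≤2k)

    P>0 : 0 < P
    P>0 = n≢0⇒n>0 λ P≡0 → contradiction
      (≤-trans (m+n≤o⇒n≤o (k * k) (large 2≤k)) (≤-reflexive (cong (4 *_) P≡0)))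
      (<⇒≱ (*-mono-< {0} {12} z<s (<⇒≤ 2≤k)))

    ratio : ∀ {e} → e < L → e ≤ k →
      v e * (k ∸ e) + v (suc e) * (L ∸ e) ≡ P * v (suc e)
    ratio {e} e<L e≤k = subst (λ k′ → ext k′ N e * (k ∸ e) + ext k′ N (suc e) * (L ∸ e) ≡ P * ext k′ N (suc e))
      (m+[n∸m]≡n e≤k)
      (ext-ratio N P e (L ∸ e) (k ∸ e) (trans (cong (λ z → N + suc z) (m+[n∸m]≡n (<⇒≤ e<L)))
        (trans N+l≡n (cong (P +_) (sym (m+[n∸m]≡n e≤k))))))

    estimate : ∀ {e} → e < L → e ≤ k → let u = L ∸ e; d = k ∸ e in
      L * (k ∸ L) * d + P * (e * d + u * u) ≤ P * (u * P)
    estimate {e} e<L e≤k = subst (λ k → L * (k ∸ L) * d + P * (e * d + u′ * u′) ≤ P * (u′ * P)) e+d≡k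
      (key-estimate {P} e u′ d (m+[n∸m]≡n (<⇒≤ e<L)) (m<n⇒0<n∸m e<L)
        (subst (λ k → L + 2 ≤ 2 * k) (sym e+d≡k) l≤2k)
        (subst (λ k → k * k + 12 * k ≤ 4 * P) (sym e+d≡k) (large 2≤k)))
      where
      u′ d : ℕ
      u′ = L ∸ e
      d = k ∸ e
      e+d≡k : e + d ≡ k
      e+d≡k = m+[n∸m]≡n e≤k

    -- This is the condition of `average-gain`. After multiplying by `k ∸ e` and adding a square
    -- term, `ratio` expresses everything through `v (suc e)`; what remains is `estimate` without
    -- its first summand.
    expansion : ∀ {e} → e < L → e * v (suc e) ≤ (L ∸ e) * v e
    expansion {e} e<L with e <? k
    ... | no e≮k rewrite ext-large k N (s≤s (≮⇒≥ e≮k)) | *-zeroʳ e = z≤n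
    ... | yes e<k = *-cancelˡ-≤ d {{>-nonZero (m<n⇒0<n∸m e<k)}}
      (+-cancelʳ-≤ (u′ * u′ * v₁) _ _ (begin
        d * (e * v₁) + u′ * u′ * v₁       ≡⟨ arith d e v₁ u′ ⟩
        (e * d + u′ * u′) * v₁            ≤⟨ *-monoˡ-≤ v₁ (*-cancelˡ-≤ P {{>-nonZero P>0}} (≤-trans (m≤n+m _ _) (estimate e<L (<⇒≤ e<k)))) ⟩
        u′ * P * v₁                       ≡⟨ *-assoc u′ P v₁ ⟩
        u′ * (P * v₁)                     ≡⟨ cong (u′ *_) (ratio e<L (<⇒≤ e<k)) ⟨
        u′ * (v e * d + v₁ * u′)          ≡⟨ arith′ u′ (v e) d v₁ ⟩
        d * (u′ * v e) + u′ * u′ * v₁     ∎))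
      where
      open ≤-Reasoning
      u′ d v₁ : ℕ
      u′ = L ∸ e
      d = k ∸ e
      v₁ = v (suc e)
      arith : ∀ d e v u → d * (e * v) + u * u * v ≡ (e * d + u * u) * v
      arith = solve-∀
      arith′ : ∀ u v d v₁ → u * (v * d + v₁ * u) ≡ d * (u * v) + u * u * v₁
      arith′ = solve-∀

    ∣E∣<L : ∀ {E : Subset L} → E ≢ ⊤ → ∣ E ∣ < L
    ∣E∣<L {E} E≢⊤ = ≤∧≢⇒< (∣p∣≤n E) (E≢⊤ ∘ ∣p∣≡n⇒p≡⊤)

    generic : ∀ E → E ≢ ⊤ → L * (a E * v ∣ E ∣ + c E * v (suc ∣ E ∣))
      ≤ sumFin L (λ x → ω (liftMissing σ x E) * ext k (suc N) ∣ E ∣)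
    generic E E≢⊤ = begin
      L * old                             ≡⟨ cong (_* old) (m+[n∸m]≡n (∣p∣≤n E)) ⟨
      (∣ E ∣ + (L ∸ ∣ E ∣)) * old         ≤⟨ average-gain ∣ E ∣ (L ∸ ∣ E ∣) (a E) (ω (join σ E)) (c E) _ _
                                               (ω-mono (m≤m⊔n (σ (outside ∷ E)) _)) (ω-mono (m≤n⊔m (σ (outside ∷ E)) _)) (expansion (∣E∣<L E≢⊤)) ⟩
      _                                   ≡⟨ liftMissing-average L σ E _ ⟨
      _                                   ∎
      where
      open ≤-Reasoning
      old : ℕ
      old = a E * v ∣ E ∣ + c E * v (suc ∣ E ∣)

    absent : ∀ E → ∣ E ∣ ≡ e → σ (outside ∷ E) ≡ 0
    absent E refl with σ (outside ∷ E) in eq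
    ... | zero  = refl
    ... | suc _ = contradiction (<∣∣ (outside ∷ E) (subst (0 <_) (sym eq) z<s)) (<-irrefl refl)

    a⊤+Δ : a ⊤ + Δ ≡ w (suc e)
    a⊤+Δ = m+[n∸m]≡n (ω-mono (σ≤ (outside ∷ ⊤)))

    -- The full set contains every `x`, is never raised, and loses at most the `Δ` term. On sets of
    -- size `e`, which have no weight of their own, the average is computed exactly. All others are
    -- `generic`.
    plain-pointwise : ∀ E →
      L * (a E * v ∣ E ∣ + c E * v (suc ∣ E ∣)) + χ (∣ E ∣ ≟ e) (c E) * (u * v e)
      ≤ sumFin L (λ x → ω (liftMissing σ x E) * ext k (suc N) ∣ E ∣)
        + (χ (E ≟ˢ ⊤) (L * (Δ * v (suc L))) + χ (∣ E ∣ ≟ e) (c E) * (e * v (suc e)))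
    plain-pointwise E with E ≟ˢ ⊤ | ∣ E ∣ ≟ e
    ... | yes refl | yes L≡e = contradiction (trans (sym L≡e) (∣⊤∣≡n L)) (<⇒≢ e<L)
    ... | no E≢⊤   | no _    = +-mono-≤ (generic E E≢⊤) z≤n
    ... | yes refl | no _    rewrite liftMissing-average L σ ⊤ (ext k (suc N) ∣ ⊤ {L} ∣) | ∣⊤∣≡n l | n∸n≡0 l = begin
      L * (a ⊤ * v L + c ⊤ * v (suc L)) + 0
        ≤⟨ +-monoˡ-≤ 0 (*-monoʳ-≤ L (+-monoʳ-≤ (a ⊤ * v L) (*-monoˡ-≤ (v (suc L)) (≤-trans (ω-mono (σ≤ (inside ∷ ⊤))) (≤-reflexive (sym a⊤+Δ)))))) ⟩
      L * (a ⊤ * v L + (a ⊤ + Δ) * v (suc L)) + 0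
        ≡⟨ arith L (a ⊤) Δ (v L) (v (suc L)) ⟩
      (L * a ⊤ + 0) * (v L + v (suc L)) + (L * (Δ * v (suc L)) + 0) ∎
      where
      open ≤-Reasoning
      arith : ∀ L a Δ x y → L * (a * x + (a + Δ) * y) + 0 ≡ (L * a + 0) * (x + y) + (L * (Δ * y) + 0)
      arith = solve-∀
    ... | no E≢⊤   | yes refl rewrite liftMissing-average L σ E (ext k (suc N) ∣ E ∣) | absent E refl =
      ≤-reflexive (trans (cong (λ z → z * (c E * v (suc e)) + c E * (u * v e)) (sym (m+[n∸m]≡n (∣p∣≤n E))))
        (arith e (L ∸ e) (c E) (v e) (v (suc e))))
      where
      arith : ∀ e u c x y → (e + u) * (c * y) + c * (u * x) ≡ (e * 0 + u * c) * (x + y) + (0 + c * (e * y))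
      arith = solve-∀

    -- The full set now has the largest weight for every `x` and gains at least the `Δ` term; a set
    -- of size `e` loses everything.
    full-pointwise : ∀ E →
      L * (a E * v ∣ E ∣ + c E * v (suc ∣ E ∣)) + χ (E ≟ˢ ⊤) (L * (Δ * v L))
      ≤ sumFin L (λ x → ω (liftFull e σ x E) * ext k (suc N) ∣ E ∣) + χ (∣ E ∣ ≟ e) (c E) * (L * v (suc e))
    full-pointwise E with E ≟ˢ ⊤ | ∣ E ∣ ≟ e
    ... | yes refl | yes L≡e = contradiction (trans (sym L≡e) (∣⊤∣≡n L)) (<⇒≢ e<L)
    ... | no E≢⊤   | no _    = +-mono-≤ (generic E E≢⊤) z≤n
    ... | yes refl | no _    rewrite sumFin-const L (w (suc e) * ext k (suc N) ∣ ⊤ {L} ∣) | ∣⊤∣≡n L = begin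
      L * (a ⊤ * v L + c ⊤ * v (suc L)) + L * (Δ * v L)
        ≤⟨ +-monoˡ-≤ _ (*-monoʳ-≤ L (+-monoʳ-≤ (a ⊤ * v L) (*-monoˡ-≤ (v (suc L)) (≤-trans (ω-mono (σ≤ (inside ∷ ⊤))) (≤-reflexive (sym a⊤+Δ)))))) ⟩
      L * (a ⊤ * v L + (a ⊤ + Δ) * v (suc L)) + L * (Δ * v L)
        ≡⟨ arith L (a ⊤) Δ (v L) (v (suc L)) ⟩
      L * ((a ⊤ + Δ) * (v L + v (suc L))) + 0
        ≡⟨ cong (λ z → L * (z * (v L + v (suc L))) + 0) a⊤+Δ ⟩
      L * (w (suc e) * (v L + v (suc L))) + 0 ∎
      where
      open ≤-Reasoning
      arith : ∀ L a Δ x y → L * (a * x + (a + Δ) * y) + L * (Δ * x) ≡ L * ((a + Δ) * (x + y)) + 0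
      arith = solve-∀
    ... | no E≢⊤   | yes refl rewrite absent E refl =
      ≤-trans (≤-reflexive (arith L (c E) (v (suc e)))) (m≤n+m _ (sumFin L (λ _ → 0)))
      where
      arith : ∀ L c y → L * (c * y) + 0 ≡ c * (L * y)
      arith = solve-∀

    old fewer : Subset L → ℕ
    old E = a E * v ∣ E ∣ + c E * v (suc ∣ E ∣)
    fewer E = χ (∣ E ∣ ≟ e) (c E)

    full : ℕ → Subset L → ℕ
    full K E = χ (E ≟ˢ ⊤) K

    -- The pointwise bound is summed over `E`. After exchanging the sums, each `x` contributes the
    -- weight of one valid level function, which is at most `X` by `ih`.
    plain-average : L * weight N (suc L) σ + S * (u * v e) ≤ L * X + (L * (Δ * v (suc L)) + S * (e * v (suc e)))
    plain-average = begin
      L * weight N (suc L) σ + S * (u * v e)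
        ≡⟨ cong₂ _+_ (sumSub-*ˡ L L old) (sumSub-*ʳ L (u * v e) fewer) ⟨
      sumSub L (λ E → L * old E) + sumSub L (λ E → fewer E * (u * v e))
        ≡⟨ sumSub-+ L (λ E → L * old E) (λ E → fewer E * (u * v e)) ⟨
      sumSub L (λ E → L * old E + fewer E * (u * v e))
        ≤⟨ sumSub-mono L plain-pointwise ⟩
      sumSub L (λ E → sumFin L (new E) + (full (L * (Δ * v (suc L))) E + fewer E * (e * v (suc e))))
        ≡⟨ sumSub-+ L (λ E → sumFin L (new E)) (λ E → full (L * (Δ * v (suc L))) E + fewer E * (e * v (suc e))) ⟩
      sumSub L (λ E → sumFin L (new E)) + sumSub L (λ E → full (L * (Δ * v (suc L))) E + fewer E * (e * v (suc e)))
        ≡⟨ cong₂ _+_ (sumSub-sumFin L L new)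
             (trans (sumSub-+ L (full (L * (Δ * v (suc L)))) (λ E → fewer E * (e * v (suc e))))
               (cong₂ _+_ (sumSub-χ L ⊤ (L * (Δ * v (suc L)))) (sumSub-*ʳ L (e * v (suc e)) fewer))) ⟩
      sumFin L (λ x → weight (suc N) L (liftMissing σ x)) + (L * (Δ * v (suc L)) + S * (e * v (suc e)))
        ≤⟨ +-monoˡ-≤ _ (≤-trans (sumFin-mono L (λ x → ih _ (liftMissing-valid σ valid x (stable x))))
             (≤-reflexive (sumFin-const L X))) ⟩
      L * X + (L * (Δ * v (suc L)) + S * (e * v (suc e))) ∎
      where
      open ≤-Reasoning
      new : Subset L → Fin L → ℕ
      new E x = ω (liftMissing σ x E) * ext k (suc N) ∣ E ∣

    full-average : L * weight N (suc L) σ + L * (Δ * v L) ≤ L * X + S * (L * v (suc e))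
    full-average = begin
      L * weight N (suc L) σ + L * (Δ * v L)
        ≡⟨ cong₂ _+_ (sumSub-*ˡ L L old) (sumSub-χ L ⊤ (L * (Δ * v L))) ⟨
      sumSub L (λ E → L * old E) + sumSub L (full (L * (Δ * v L)))
        ≡⟨ sumSub-+ L (λ E → L * old E) (full (L * (Δ * v L))) ⟨
      sumSub L (λ E → L * old E + full (L * (Δ * v L)) E)
        ≤⟨ sumSub-mono L full-pointwise ⟩
      sumSub L (λ E → sumFin L (new E) + fewer E * (L * v (suc e)))
        ≡⟨ sumSub-+ L (λ E → sumFin L (new E)) (λ E → fewer E * (L * v (suc e))) ⟩
      sumSub L (λ E → sumFin L (new E)) + sumSub L (λ E → fewer E * (L * v (suc e)))
        ≡⟨ cong₂ _+_ (sumSub-sumFin L L new) (sumSub-*ʳ L (L * v (suc e)) fewer) ⟩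
      sumFin L (λ x → weight (suc N) L (liftFull e σ x)) + S * (L * v (suc e))
        ≤⟨ +-monoˡ-≤ _ (≤-trans
             (sumFin-mono L (λ x → ih _ (liftFull-valid σ top (λ x → liftMissing-valid σ valid x (stable x)) e<L x)))
             (≤-reflexive (sumFin-const L X))) ⟩
      L * X + S * (L * v (suc e)) ∎
      where
      open ≤-Reasoning
      new : Subset L → Fin L → ℕ
      new E x = ω (liftFull e σ x E) * ext k (suc N) ∣ E ∣

    -- This is `ext-ratio` at `e = L`, where `u = 0`; beyond `k` the left side vanishes.
    v-ratio-L : v (suc L) * P ≤ v L * (k ∸ L)
    v-ratio-L with L ≤? k
    ... | no L≰k rewrite ext-large k N (m<n⇒m<1+n (≰⇒> L≰k)) = z≤n
    ... | yes L≤k = ≤-reflexive (trans (*-comm (v (suc L)) P)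
      (trans (sym (ratio′ L≤k)) (trans (cong (v L * (k ∸ L) +_) (*-zeroʳ (v (suc L)))) (+-identityʳ _))))
      where
      ratio′ : L ≤ k → v L * (k ∸ L) + v (suc L) * 0 ≡ P * v (suc L)
      ratio′ L≤k = subst (λ k′ → ext k′ N L * (k ∸ L) + ext k′ N (suc L) * 0 ≡ P * ext k′ N (suc L))
        (m+[n∸m]≡n L≤k)
        (ext-ratio N P L 0 (k ∸ L) (trans (cong (λ z → N + suc z) (+-identityʳ L))
          (trans N+l≡n (cong (P +_) (sym (m+[n∸m]≡n L≤k))))))

    -- If liftFull loses on average then liftMissing does not.
    plain-wins : Δ * v L ≤ S * v (suc e) →
      L * (Δ * v (suc L)) + S * (e * v (suc e)) ≤ S * (u * v e)
    plain-wins loses with e <? k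
    ... | no e≮k
      rewrite ext-large k N (s≤s (≮⇒≥ e≮k)) | ext-large k N (s≤s (≤-trans (≮⇒≥ e≮k) (<⇒≤ e<L)))
            | *-zeroʳ Δ | *-zeroʳ l | *-zeroʳ e | *-zeroʳ S = z≤n
    -- The factor `P * d` and the added term make both ratios applicable: `v-ratio-L` trades
    -- `v (suc L)` for `v L`, `loses` trades that for `S * v₁`, and after `estimate` the identity
    -- `ratio` brings back `v e`.
    ... | yes e<k = *-cancelˡ-≤ (P * d) {{m*n≢0 P d {{>-nonZero P>0}} {{>-nonZero (m<n⇒0<n∸m e<k)}}}}
      (+-cancelʳ-≤ (S * v₁ * (P * (u * u))) _ _ (begin
        P * d * (L * (Δ * v (suc L)) + S * (e * v₁)) + S * v₁ * (P * (u * u))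
          ≡⟨ regroup P d L Δ (v (suc L)) S e v₁ u ⟩
        L * d * Δ * (v (suc L) * P) + S * v₁ * (P * (e * d + u * u))
          ≤⟨ +-monoˡ-≤ _ (*-monoʳ-≤ (L * d * Δ) v-ratio-L) ⟩
        L * d * Δ * (v L * (k ∸ L)) + S * v₁ * (P * (e * d + u * u))
          ≡⟨ cong (_+ S * v₁ * (P * (e * d + u * u))) (regroup₁ L d Δ (v L) (k ∸ L)) ⟩
        L * (k ∸ L) * d * (Δ * v L) + S * v₁ * (P * (e * d + u * u))
          ≤⟨ +-monoˡ-≤ _ (*-monoʳ-≤ (L * (k ∸ L) * d) loses) ⟩
        L * (k ∸ L) * d * (S * v₁) + S * v₁ * (P * (e * d + u * u))
          ≡⟨ factor (L * (k ∸ L) * d) (S * v₁) (P * (e * d + u * u)) ⟩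
        S * v₁ * (L * (k ∸ L) * d + P * (e * d + u * u))
          ≤⟨ *-monoʳ-≤ (S * v₁) (estimate e<L (<⇒≤ e<k)) ⟩
        S * v₁ * (P * (u * P))
          ≡⟨ regroup₂ S v₁ P u ⟩
        P * u * S * (P * v₁)
          ≡⟨ cong (P * u * S *_) (ratio e<L (<⇒≤ e<k)) ⟨
        P * u * S * (v e * d + v₁ * u)
          ≡⟨ regroup₃ P u S (v e) d v₁ ⟩
        P * d * (S * (u * v e)) + S * v₁ * (P * (u * u)) ∎))
      where
      open ≤-Reasoning
      d v₁ : ℕ
      d = k ∸ e
      v₁ = v (suc e)
      regroup : ∀ P d L Δ y S e v u →
        P * d * (L * (Δ * y) + S * (e * v)) + S * v * (P * (u * u)) ≡ L * d * Δ * (y * P) + S * v * (P * (e * d + u * u))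
      regroup = solve-∀
      regroup₁ : ∀ L d Δ x j → L * d * Δ * (x * j) ≡ L * j * d * (Δ * x)
      regroup₁ = solve-∀
      factor : ∀ a b c → a * b + b * c ≡ b * (a + c)
      factor = solve-∀
      regroup₂ : ∀ S v P u → S * v * (P * (u * P)) ≡ P * u * S * (P * v)
      regroup₂ = solve-∀
      regroup₃ : ∀ P u S x d v → P * u * S * (x * d + v * u) ≡ P * d * (S * (u * x)) + S * v * (P * (u * u))
      regroup₃ = solve-∀

    average-bound : weight N (suc L) σ ≤ X
    -- Up to the factor `L`, `liftFull` gains at least `Δ * v L` and loses at most `S * v (suc e)`;
    -- the larger of the two selects the option.
    average-bound = *-cancelˡ-≤ L ([ keep-⊤ , drop-⊤ ]′ (≤-total (S * v (suc e)) (Δ * v L)))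
      where
      flip : ∀ S L x → S * (L * x) ≡ L * (S * x)
      flip = solve-∀
      keep-⊤ : S * v (suc e) ≤ Δ * v L → L * weight N (suc L) σ ≤ L * X
      keep-⊤ wins = +-cancelʳ-≤ (L * (Δ * v L)) _ _ (≤-trans full-average
        (+-monoʳ-≤ (L * X) (≤-trans (≤-reflexive (flip S L (v (suc e)))) (*-monoʳ-≤ L wins))))
      drop-⊤ : Δ * v L ≤ S * v (suc e) → L * weight N (suc L) σ ≤ L * X
      drop-⊤ loses = +-cancelʳ-≤ (S * (u * v e)) _ _ (≤-trans plain-average (+-monoʳ-≤ (L * X) (plain-wins loses)))

  -- Induction on the number of remaining points.

  weight-step : ∀ l N → N + (2 + l) ≡ P + k → (∀ ρ → Valid ρ → weight (suc N) (suc l) ρ ≤ X) →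
    ∀ σ → Valid σ → weight N (2 + l) σ ≤ X
  weight-step l N N+l≡n ih σ valid with shift-all (allFin (suc l)) σ valid
  ... | τ , τ-valid , τ-stable , τ-sum =
    ≤-trans (≤-reflexive (sym (τ-sum ω (ext k N)))) (by-size (2 * k ≤? 2 + l) (extreme N (2 + l) τ N+l≡n τ-valid))
    where
    stable : ∀ x → Stable τ x
    stable x = τ-stable x (∈-allFin x)
    by-size : Dec (2 * k ≤ 2 + l) → weight N (2 + l) τ ≤ X ⊎ (∃ λ e → suc e < 2 + l × Top τ e) → weight N (2 + l) τ ≤ X
    by-size (yes 2k≤) _ = ≤-trans (liftSmall-weight N (suc l) τ)
      (ih (liftSmall k τ) (liftSmall-valid k τ τ-valid stable 2k≤))
    by-size (no _)    (inj₁ bound) = bound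
    by-size (no 2k≰)  (inj₂ (e , s≤s e<L , top)) = Averaging.average-bound N l N+l≡n
      (≤-trans (≤-reflexive (cong suc (+-comm l 2))) (≰⇒> 2k≰)) ih τ τ-valid stable e e<L top

  -- A removed point becomes free, so `N + l` stays constant. For `l` ≤ 1 only the terminal cases of
  -- `extreme` are possible, as the other one has `suc e < l`.
  weight-bound : ∀ l N → N + l ≡ P + k → ∀ σ → Valid σ → weight N l σ ≤ X
  weight-bound zero N N+l≡n σ valid with extreme N 0 σ N+l≡n valid
  ... | inj₁ bound = bound
  weight-bound (suc zero) N N+l≡n σ valid with extreme N 1 σ N+l≡n valid
  ... | inj₁ bound = bound
  ... | inj₂ (_ , s≤s () , _)
  weight-bound (suc (suc l)) N N+l≡n =
    weight-step l N N+l≡n (weight-bound (suc l) (suc N) (trans (sym (+-suc N (suc l))) N+l≡n))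

-- Multiplicities, positive summands and monotonicity of `M`.

occ : ∀ {n} → List (Subset n) → Subset n → ℕ
occ []      A = 0
occ (B ∷ 𝓕) A = χ (A ≟ˢ B) 1 + occ 𝓕 A

sumSub-occ : ∀ {n} (𝓕 : List (Subset n)) → sumSub n (occ 𝓕) ≡ length 𝓕
sumSub-occ {n} []      = sumSub-0 n
sumSub-occ {n} (B ∷ 𝓕) = trans (sumSub-+ n (λ A → χ (A ≟ˢ B) 1) (occ 𝓕)) (cong₂ _+_ (sumSub-χ n B 1) (sumSub-occ 𝓕))

0<occ⇒∈ : ∀ {n} (𝓕 : List (Subset n)) {A} → 0 < occ 𝓕 A → A ∈ 𝓕
0<occ⇒∈ (B ∷ 𝓕) {A} pos with A ≟ˢ B
... | yes A≡B = here A≡B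
... | no _    = there (0<occ⇒∈ 𝓕 pos)

occ≤1 : ∀ {n} {𝓕 : List (Subset n)} → Unique 𝓕 → ∀ A → occ 𝓕 A ≤ 1
occ≤1 []                  A = z≤n
occ≤1 {𝓕 = B ∷ 𝓕} (B∉ ∷ unique) A with A ≟ˢ B
... | no _     = occ≤1 unique A
... | yes refl = s≤s (≮⇒≥ λ pos → All.lookup B∉ (0<occ⇒∈ 𝓕 pos) refl)

sumFin-pos : ∀ n (f : Fin n → ℕ) → 0 < sumFin n f → ∃ λ i → 0 < f i
sumFin-pos (suc n) f pos with f zero in eq
... | suc _ = zero , subst (0 <_) (sym eq) z<s
... | zero  with sumFin-pos n (f ∘ suc) pos
...   | i , fi>0 = suc i , fi>0

sumFin-last : ∀ n (f : Fin n → ℕ) → 0 < sumFin n f →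
  ∃ λ i → 0 < f i × ∀ j → 0 < f j → toℕ j ≤ toℕ i
sumFin-last (suc n) f pos with 0 <? sumFin n (f ∘ suc)
... | yes tail>0 with sumFin-last n (f ∘ suc) tail>0
...   | i , fi>0 , last = suc i , fi>0 , λ { zero _ → z≤n ; (suc j) fj>0 → s≤s (last j fj>0) }
sumFin-last (suc n) f pos | no tail≯0 = zero , head>0 , λ { zero _ → z≤n ; (suc j) fj>0 → contradiction (tail>0 j fj>0) tail≯0 }
  where
  head>0 : 0 < f zero
  head>0 = subst (0 <_) (trans (cong (f zero +_) (n≤0⇒n≡0 (≮⇒≥ tail≯0))) (+-identityʳ (f zero))) pos
  tail>0 : ∀ {n} {g : Fin n → ℕ} j → 0 < g j → 0 < sumFin n g
  tail>0 {suc n} {g} zero    gj>0 = ≤-trans gj>0 (m≤m+n (g zero) _)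
  tail>0 {suc n} {g} (suc j) gj>0 = ≤-trans (tail>0 j gj>0) (m≤n+m _ (g zero))

-- Applied first across the rows and then inside one row, this finds two distinct families
-- containing a given set.
sumFin-two : ∀ n (f : Fin n → ℕ) → 2 ≤ sumFin n f →
  (∃ λ i → 2 ≤ f i) ⊎ (∃ λ i → ∃ λ j → i ≢ j × 0 < f i × 0 < f j)
sumFin-two (suc n) f 2≤ with f zero in eq
... | suc (suc _) = inj₁ (zero , subst (2 ≤_) (sym eq) (s≤s (s≤s z≤n)))
... | suc zero with sumFin-pos n (f ∘ suc) (s≤s⁻¹ 2≤)
...   | j , fj>0 = inj₂ (zero , suc j , (λ ()) , subst (0 <_) (sym eq) z<s , fj>0)
sumFin-two (suc n) f 2≤ | zero with sumFin-two n (f ∘ suc) 2≤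
... | inj₁ (i , 2≤fi)                  = inj₁ (suc i , 2≤fi)
... | inj₂ (i , j , i≢j , fi>0 , fj>0) = inj₂ (suc i , suc j , i≢j ∘ Fin.suc-injective , fi>0 , fj>0)

maxUpTo-upper : ∀ k (f : ℕ → ℕ) {s} → s ≤ k → f s ≤ maxUpTo k f
maxUpTo-upper zero    f z≤n = ≤-refl
maxUpTo-upper (suc k) f s≤1+k with m≤n⇒m<n∨m≡n s≤1+k
... | inj₁ s<1+k = ≤-trans (maxUpTo-upper k f (s≤s⁻¹ s<1+k)) (m≤m⊔n _ _)
... | inj₂ refl  = m≤n⊔m (maxUpTo k f) _

restrict-mono : ∀ r x {s t} → s ≤ t → (if r <ᵇ s then x else 0) ≤ (if r <ᵇ t then x else 0)
restrict-mono r x {s} {t} s≤t with r <ᵇ s in r<s | r <ᵇ t in r<t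
... | false | _     = z≤n
... | true  | true  = ≤-refl
... | true  | false = contradiction (subst T r<t (<⇒<ᵇ (≤-trans (<ᵇ⇒< r s (subst T (sym r<s) _)) s≤t))) λ ()

M-mono : ∀ k m {s t} → s ≤ t → M k m s ≤ M k m t
M-mono k m s≤t = ⊔-monoʳ-≤ 1 (sumFin-mono k (λ r → restrict-mono (toℕ r) (m r) s≤t))

-- From families to a level function.

module Families
  (k n : ℕ) (m : Fin k → ℕ) (F : (i : Fin k) → Fin (m i) → List (Subset n))
  (kfam : ∀ i j → IsKFamily k (F i j))
  (cross : ∀ i j i′ j′ → _≢_ {A = Σ (Fin k) (λ i → Fin (m i))} (i , j) (i′ , j′) →
    CrossInt (suc (toℕ i ⊔ toℕ i′)) (F i j) (F i′ j′))
  where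

  Index : Set
  Index = Σ (Fin k) (λ i → Fin (m i))

  _∈ᶠ_ : Subset n → Index → Set
  A ∈ᶠ (i , j) = A ∈ F i j

  row : Subset n → Fin k → ℕ
  row A i = sumFin (m i) (λ j → occ (F i j) A)

  count : Subset n → ℕ
  count A = sumFin k (row A)

  row-pos : ∀ A i → 0 < row A i → ∃ λ j → A ∈ F i j
  row-pos A i pos with sumFin-pos (m i) _ pos
  ... | j , occ>0 = j , 0<occ⇒∈ (F i j) occ>0

  count-pos : ∀ A → 0 < count A → ∃ λ p → A ∈ᶠ p
  count-pos A pos with sumFin-pos k (row A) pos
  ... | i , row>0 with row-pos A i row>0
  ...   | j , A∈ = (i , j) , A∈

  two-indices : ∀ A → 2 ≤ count A → ∃ λ p → ∃ λ q → p ≢ q × A ∈ᶠ p × A ∈ᶠ q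
  two-indices A 2≤ with sumFin-two k (row A) 2≤
  ... | inj₂ (i , i′ , i≢i′ , pos , pos′) with row-pos A i pos | row-pos A i′ pos′
  ...   | j , A∈ | j′ , A∈′ = (i , j) , (i′ , j′) , i≢i′ ∘ cong proj₁ , A∈ , A∈′
  two-indices A 2≤ | inj₁ (i , 2≤row) with sumFin-two (m i) _ 2≤row
  ... | inj₁ (j , 2≤occ) = contradiction (≤-trans 2≤occ (occ≤1 (proj₁ (kfam i j)) A)) λ { (s≤s ()) }
  ... | inj₂ (j , j′ , j≢j′ , pos , pos′) =
    (i , j) , (i , j′) , (λ { refl → j≢j′ refl }) , 0<occ⇒∈ (F i j) pos , 0<occ⇒∈ (F i j′) pos′

  _≟ᴵ_ : ∀ (p q : Index) → Dec (p ≡ q)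
  _≟ᴵ_ = Product.≡-dec Fin._≟_ Fin._≟_

  another-index : ∀ A → 2 ≤ count A → ∀ p → ∃ λ q → q ≢ p × A ∈ᶠ q
  another-index A 2≤ p with two-indices A 2≤
  ... | q , q′ , q≢q′ , A∈q , A∈q′ with q ≟ᴵ p
  ...   | no q≢p   = q , q≢p , A∈q
  ...   | yes refl = q′ , q≢q′ ∘ sym , A∈q′

  -- Rows after `i` contribute nothing, and row `r` contributes at most `m r` because the families
  -- are duplicate-free.
  count≤M : ∀ A (i : Fin k) → (∀ i′ → 0 < row A i′ → toℕ i′ ≤ toℕ i) → count A ≤ M k m (suc (toℕ i))
  count≤M A i last = ≤-trans (sumFin-mono k pointwise) (m≤n⊔m 1 _)
    where
    row≤ : ∀ r → row A r ≤ m r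
    row≤ r = ≤-trans (sumFin-mono (m r) (λ j → occ≤1 (proj₁ (kfam r j)) A))
      (≤-reflexive (trans (sumFin-const (m r) 1) (*-identityʳ (m r))))
    pointwise : ∀ r → row A r ≤ (if toℕ r <ᵇ suc (toℕ i) then m r else 0)
    pointwise r with toℕ r <ᵇ suc (toℕ i) in r≤i
    ... | true  = row≤ r
    ... | false = ≮⇒≥ λ pos → subst T r≤i (<⇒<ᵇ (s≤s (last r pos)))

  -- The field `intersects` ranges over all families, those containing `A` included, so that
  -- validity follows without comparing indices.
  record Level (A : Subset n) : Set where
    field
      code        : ℕ
      count≤      : count A ≤ levelWeight (M k m) code
      present     : 0 < code → ∃ λ p → A ∈ᶠ p
      intersects  : ∀ p {B} → B ∈ᶠ p → code ≤ suc ∣ A ∩ B ∣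

  level : ∀ A → Level A
  level A with count A in count≡
  ... | zero = record { code = 0 ; count≤ = ≤-reflexive count≡ ; present = λ () ; intersects = λ _ _ → z≤n }
  -- Level 0: the single occurrence is covered by the 1 in the maximum defining `M`.
  ... | suc zero = record
    { code = 1 ; count≤ = ≤-trans (≤-reflexive count≡) (m≤m⊔n 1 (partialSum k m 0))
    ; present = λ _ → count-pos A (subst (0 <_) (sym count≡) z<s) ; intersects = λ _ _ → s≤s z≤n }
  ... | suc (suc c) with sumFin-last k (row A) (subst (0 <_) (sym count≡) z<s)
  ...   | i , pos , last with row-pos A i pos
  ...     | j , A∈ = record
    -- Index `i` stands for row `toℕ i` + 1 of the theorem, which is the level; its code is one
    -- more.
    { code = 2 + toℕ i ; count≤ = count≤M A i last ; present = λ _ → (i , j) , A∈ ; intersects = meets }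
    where
    meets : ∀ p {B} → B ∈ᶠ p → 2 + toℕ i ≤ suc ∣ A ∩ B ∣
    meets p@(i′ , j′) B∈ with p ≟ᴵ (i , j)
    ... | no p≢ = s≤s (≤-trans (s≤s (m≤m⊔n (toℕ i) (toℕ i′))) (cross i j i′ j′ (p≢ ∘ sym) A∈ B∈))
    -- `B` lies in the family chosen for `A`, so a second family containing `A` is crossed with it;
    -- the bound still involves row `i`.
    ... | yes refl with another-index A (subst (2 ≤_) (sym count≡) (s≤s (s≤s z≤n))) (i , j)
    ...   | (i″ , j″) , q≢p , A∈′ = s≤s (≤-trans (s≤s (m≤n⊔m (toℕ i″) (toℕ i))) (cross i″ j″ i j q≢p A∈′ B∈))

  σ : Subset n → ℕ
  σ A = Level.code (level A)

  σ-valid : Valid σ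
  σ-valid A B A>0 B>0 with Level.present (level A) A>0 | Level.present (level B) B>0
  ... | p , A∈ | q , B∈ = ⊔-lub (Level.intersects (level A) q B∈)
    (≤-trans (Level.intersects (level B) p A∈) (≤-reflexive (cong (suc ∘ ∣_∣) (∩-comm B A))))

  sum-count : sumFin k (λ i → sumFin (m i) (λ j → length (F i j))) ≡ sumSub n count
  sum-count = sym (trans (sumSub-sumFin n k row) (sumFin-cong k λ i →
    trans (sumSub-sumFin n (m i) (λ A j → occ (F i j) A)) (sumFin-cong (m i) λ j → sumSub-occ (F i j))))

  module _ (k≤n : k ≤ n) (large : 2 ≤ k → k * k + 12 * k ≤ 4 * (n ∸ k)) where
    bound : ℕ
    bound = maxUpTo k (λ s → M k m s * ((n ∸ s) C (k ∸ s)))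

    star-bound : ∀ s N → N + s ≡ n ∸ k + k → M k m s * ext k N s ≤ bound
    star-bound s N N+s≡ with s ≤? k
    ... | no s≰k rewrite ext-large k N (≰⇒> s≰k) | *-zeroʳ (M k m s) = z≤n
    ... | yes s≤k = ≤-trans (≤-reflexive (cong (M k m s *_)
        (trans (ext-∸ N s≤k) (cong (_C (k ∸ s)) (trans (sym (m+n∸n≡m N s)) (cong (_∸ s) (trans N+s≡ (m∸n+n≡m k≤n))))))))
      (maxUpTo-upper k (λ s → M k m s * ((n ∸ s) C (k ∸ s))) s≤k)

    open Pulling k (n ∸ k) bound large (M k m) (M-mono k m) star-bound

    count≤weight : ∀ A → count A ≤ ω (σ A) * ext k 0 ∣ A ∣
    count≤weight A with ∣ A ∣ ≟ k
    ... | yes _ = ≤-trans (Level.count≤ (level A)) (≤-reflexive (sym (*-identityʳ _)))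
    ... | no ∣A∣≢k = ≤-trans (≮⇒≥ λ pos → ∣A∣≢k (size (count-pos A pos))) z≤n
      where
      size : (∃ λ p → A ∈ᶠ p) → ∣ A ∣ ≡ k
      size ((i , j) , A∈) = All.lookup (proj₂ (kfam i j)) A∈

    families-bound : sumFin k (λ i → sumFin (m i) (λ j → length (F i j))) ≤ bound
    families-bound = ≤-trans (≤-reflexive sum-count) (≤-trans (sumSub-mono n count≤weight)
      (weight-bound n 0 (sym (m∸n+n≡m k≤n)) σ σ-valid))

-- The size conditions on `n`.

1≤k⇒k≤n : ∀ k n → 1 ≤ k → (k ^ 3 + 2 * k ^ 2 + k ≤ 2 * n) ⊎ (k ^ 2 + 20 * k + 4 * 0 ≤ 4 * n) → k ≤ n
1≤k⇒k≤n (suc j) n _ (inj₁ cubic) = *-cancelˡ-≤ 2 (≤-trans (m+n≤o⇒m≤o _ (≤-reflexive (expand j))) cubic)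
  where
  expand : ∀ j → let k = suc j in
    2 * k + (k * (k * j) + 3 * (k * j) + 2 * k) ≡ k * (k * (k * 1)) + 2 * (k * (k * 1)) + k
  expand = solve-∀
1≤k⇒k≤n k n _ (inj₂ quadratic) = *-cancelˡ-≤ 4 (≤-trans (m+n≤o⇒m≤o _ (≤-reflexive (expand k))) quadratic)
  where
  expand : ∀ k → 4 * k + (k * k + 16 * k) ≡ k * (k * 1) + 20 * k + 4 * 0
  expand = solve-∀

-- The claim amounts to `k * k + 16 * k ≤ 4 * n`. Twice the cubic exceeds the left side by (k - 2) k
-- (2k + 7), hence the premise `2 ≤ k`; the averaging step only occurs for such `k`.
large-n : ∀ k n → k ≤ n → (k ^ 3 + 2 * k ^ 2 + k ≤ 2 * n) ⊎ (k ^ 2 + 20 * k + 4 * 0 ≤ 4 * n) →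
  2 ≤ k → k * k + 12 * k ≤ 4 * (n ∸ k)
large-n k n k≤n size 2≤k = +-cancelʳ-≤ (4 * k) _ _ (begin
  k * k + 12 * k + 4 * k   ≡⟨ collect k ⟩
  k * k + 16 * k           ≤⟨ by-cases size ⟩
  4 * n                    ≡⟨ cong (4 *_) (m∸n+n≡m k≤n) ⟨
  4 * (n ∸ k + k)          ≡⟨ *-distribˡ-+ 4 (n ∸ k) k ⟩
  4 * (n ∸ k) + 4 * k      ∎)
  where
  open ≤-Reasoning
  collect : ∀ k → k * k + 12 * k + 4 * k ≡ k * k + 16 * k
  collect = solve-∀
  cubic : ∀ j → let k = 2 + j in
    k * k + 16 * k + j * (k * (2 * k + 7)) ≡ 2 * (k * (k * (k * 1)) + 2 * (k * (k * 1)) + k)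
  cubic = solve-∀
  quadratic : ∀ k → k * k + 16 * k + 4 * k ≡ k * (k * 1) + 20 * k + 4 * 0
  quadratic = solve-∀
  by-cases : (k ^ 3 + 2 * k ^ 2 + k ≤ 2 * n) ⊎ (k ^ 2 + 20 * k + 4 * 0 ≤ 4 * n) → k * k + 16 * k ≤ 4 * n
  by-cases (inj₁ le) = begin
    k * k + 16 * k                  ≤⟨ subst (λ k → k * k + 16 * k ≤ 2 * (k ^ 3 + 2 * k ^ 2 + k)) (m+[n∸m]≡n 2≤k)
                                         (m+n≤o⇒m≤o _ (≤-reflexive (cubic (k ∸ 2)))) ⟩
    2 * (k ^ 3 + 2 * k ^ 2 + k)     ≤⟨ *-monoʳ-≤ 2 le ⟩
    2 * (2 * n)                     ≡⟨ *-assoc 2 2 n ⟨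
    4 * n                           ∎
  by-cases (inj₂ le) = ≤-trans (m+n≤o⇒m≤o _ (≤-reflexive (quadratic k))) le

theorem1p3 : ∃ λ (D : ℕ) →
    ∀ (k n : ℕ) → 1 ≤ k →
    (k ^ 3 + 2 * k ^ 2 + k ≤ 2 * n) ⊎ (k ^ 2 + 20 * k + 4 * D ≤ 4 * n) →
    (m : Fin k → ℕ) →
    (F : (i : Fin k) → Fin (m i) → List (Subset n)) →
    (∀ i j → IsKFamily k (F i j)) →
    (∀ i j i′ j′ → _≢_ {A = Σ (Fin k) (λ i → Fin (m i))} (i , j) (i′ , j′) →
      CrossInt (suc (toℕ i ⊔ toℕ i′)) (F i j) (F i′ j′)) →
    sumFin k (λ i → sumFin (m i) (λ j → length (F i j)))
      ≤ maxUpTo k (λ s → M k m s * ((n ∸ s) C (k ∸ s)))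
-- `D = 0` suffices: n ≥ k²/4 + 5k gives n - k ≥ k²/4 + 4k, and the estimates use k²/4 + 3k.
theorem1p3 = 0 , λ k n 1≤k size m F kfam cross →
  let k≤n = 1≤k⇒k≤n k n 1≤k size
  in Families.families-bound k n m F kfam cross k≤n (large-n k n k≤n size)
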